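{- Let $S$ be a recurrent specular set on the finite alphabet $A$ relative to the involution $\theta$. For any subgroup $H$ of finite index of the group $G_\theta$, the set of prime words in $S$ with respect to $H$ is a monoidal basis of $H$.
   Context: Words are over a finite alphabet $A$; $\varepsilon$ is the empty word. A set $S$ of words on $A$ is factorial if it contains $A$ and all the factors of its elements. For $w\in S$ let $L(w)=\{a\in A\mid aw\in S\}$, $R(w)=\{a\in A\mid wa\in S\}$, $B(w)=\{(a,b)\in A\times A\mid awb\in S\}$. A factorial set $S$ is biextendable if $B(w)\neq\emptyset$ for all $w\in S$. The extension graph $\mathcal{E}(w)$ is the undirected graph whose vertex set is the disjoint union of $L(w)$ and $R(w)$ and whose edges are the pairs in $B(w)$. A biextendable set $S$ is a tree set of characteristic $c$ if $\mathcal{E}(w)$ is a tree for every nonempty $w\in S$ and $\mathcal{E}(\varepsilon)$ is a disjoint union of $c$ trees. Let $\theta$ be an involution on $A$ (possibly with fixed points) and let $G_\theta$ be the group generated by $A$ with relations $a\theta(a)=1$, $a\in A$ (so $a^{ -1}=\theta(a)$). A word is reduced if it has no factor $a\theta(a)$ with $a\in A$; every element of $G_\theta$ is represented by a unique reduced word, and reduced words are identified with elements of $G_\theta$. A laminary set on $A$ relative to $\theta$ is a biextendable set of reduced words closed under taking inverses. A specular set is a laminary set which is a tree set of characteristic $2$. A set $S\ne\{\varepsilon\}$ is recurrent if it is factorial and for all $u,w\in S$ there is $v\in S$ with $uvw\in S$. For a subgroup $H$ of $G_\theta$, the set of prime words in $S$ with respect to $H$ is the set of nonempty words in $H\cap S$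 without a proper nonempty prefix in $H\cap S$. A set $X$ is a monoidal basis of a group $H$ if $X\subset H$ is closed under taking inverses, the monoid generated by $X$ is $H$, and any product $x_1x_2\cdots x_m$ ($m\ge1$) of elements of $X$ such that $x_kx_{k+1}\neq 1$ for $1\le k\le m-1$ is different from $1$. -}

module Defs where

open import Algebra.Bundles using (Group)
open import Algebra.Definitions using (Involutive)
open import Data.Fin.Base using (Fin)
open import Data.List.Base using (List; []; _∷_; _++_; [_]; foldr; map; reverse)
open import Data.List.Properties using (++-assoc; ++-identityʳ; unfold-reverse)
open import Data.List.Relation.Unary.All using (All)
open import Data.List.Relation.Unary.Linked using (Linked)
open import Data.List.Relation.Unary.Unique.Propositional using (Unique)
open import Data.Nat.Base using (ℕ)
open import Data.Product.Base using (∃; ∃₂; _×_; _,_)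
open import Data.Sum.Base using (_⊎_; inj₁; inj₂)
open import Level using (Level; _⊔_; 0ℓ)
open import Relation.Binary.Core using (Rel)
open import Relation.Binary.Construct.Closure.ReflexiveTransitive using (Star)
open import Relation.Binary.Definitions using (Symmetric)
open import Relation.Binary.PropositionalEquality.Core using (_≡_; _≢_; refl; sym; subst)
open import Relation.Nullary.Negation.Core using (¬_)
open import Relation.Unary using (Pred; _∈_; _⊆_; _≐_; _∩_; ｛_｝)

private
  variable
    a c ℓ s h x : Level

-- The vertices are the elements of a subset of the carrier V, so that they
-- are compared by the equality of V, whatever the proofs of membership.
-- _∼_ only matters between vertices (see Adjacent).

record Graph (V : Set a) (ℓ : Level) : Set (a ⊔ Level.suc ℓ) where
  field
    Vertex : Pred V ℓ
    _∼_    : Rel V ℓ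
    ∼-sym  : Symmetric _∼_

  Adjacent : Rel V ℓ
  Adjacent u v = u ∈ Vertex × v ∈ Vertex × u ∼ v

  Connected : Set (a ⊔ ℓ)
  Connected = ∀ {u v} → u ∈ Vertex → v ∈ Vertex → Star Adjacent u v

  -- A cycle is a closed path  u, vs, w, u  through at least three pairwise
  -- distinct vertices.
  record Cycle : Set (a ⊔ ℓ) where
    field
      u w      : V
      vs       : List V
      long     : vs ≢ []
      distinct : Unique (u ∷ vs ++ [ w ])
      path     : Linked Adjacent (u ∷ vs ++ [ w ])
      closing  : Adjacent w u

  record IsTree : Set (a ⊔ ℓ) where
    field
      nonempty  : ∃ Vertex
      connected : Connected
      acyclic   : ¬ Cycle

induced : {V : Set a} → Graph V ℓ → Pred V ℓ → Graph V ℓ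
induced 𝒢 C = record
  { Vertex = Graph.Vertex 𝒢 ∩ C
  ; _∼_    = Graph._∼_ 𝒢
  ; ∼-sym  = Graph.∼-sym 𝒢
  }

record IsDisjointUnionOfTrees {V : Set a} (𝒢 : Graph V ℓ) (k : ℕ) : Set (a ⊔ Level.suc ℓ) where
  open Graph 𝒢
  field
    part     : Fin k → Pred V ℓ
    covering : ∀ {v} → v ∈ Vertex → ∃ λ i → v ∈ part i
    disjoint : ∀ {i j v} → v ∈ part i → v ∈ part j → i ≡ j
    noCross  : ∀ {i u v} → Adjacent u v → u ∈ part i → v ∈ part i
    trees    : ∀ i → Graph.IsTree (induced 𝒢 (part i))

Word : ℕ → Set
Word n = List (Fin n)

module _ {n : ℕ} where

  L : Pred (Word n) s → Word n → Pred (Fin n) s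
  L S w a = (a ∷ w) ∈ S

  R : Pred (Word n) s → Word n → Pred (Fin n) s
  R S w b = (w ++ [ b ]) ∈ S

  B : Pred (Word n) s → Word n → Rel (Fin n) s
  B S w a b = (a ∷ w ++ [ b ]) ∈ S

  record IsFactorial (S : Pred (Word n) s) : Set s where
    field
      letters : ∀ a → [ a ] ∈ S
      factors : ∀ u v w → (u ++ v ++ w) ∈ S → v ∈ S

  record IsBiextendable (S : Pred (Word n) s) : Set s where
    field
      factorial  : IsFactorial S
      extendable : ∀ {w} → w ∈ S → ∃₂ (B S w)

  data ExtVertex (S : Pred (Word n) s) (w : Word n) : Pred (Fin n ⊎ Fin n) s where
    left  : ∀ {a} → a ∈ L S w → ExtVertex S w (inj₁ a)
    right : ∀ {b} → b ∈ R S w → ExtVertex S w (inj₂ b)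

  data ExtEdge (S : Pred (Word n) s) (w : Word n) : Rel (Fin n ⊎ Fin n) s where
    edge  : ∀ {a b} → B S w a b → ExtEdge S w (inj₁ a) (inj₂ b)
    edge⁻ : ∀ {a b} → B S w a b → ExtEdge S w (inj₂ b) (inj₁ a)

  extensionGraph : Pred (Word n) s → Word n → Graph (Fin n ⊎ Fin n) s
  extensionGraph S w = record
    { Vertex = ExtVertex S w
    ; _∼_    = ExtEdge S w
    ; ∼-sym  = λ { (edge p) → edge⁻ p ; (edge⁻ p) → edge p }
    }

  record IsTreeSet (S : Pred (Word n) s) (k : ℕ) : Set (Level.suc s) where
    field
      biextendable : IsBiextendable S
      nonemptyWord : ∀ {w} → w ∈ S → w ≢ [] → Graph.IsTree (extensionGraph S w)
      emptyWord    : IsDisjointUnionOfTrees (extensionGraph S []) k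

  record IsRecurrent (S : Pred (Word n) s) : Set s where
    field
      nontrivial : ¬ (S ≐ ｛ [] ｝)
      factorial  : IsFactorial S
      recurrent  : ∀ {u w} → u ∈ S → w ∈ S → ∃ λ v → v ∈ S × (u ++ v ++ w) ∈ S

module _ {n : ℕ} (θ : Fin n → Fin n) where

  inverse : Word n → Word n
  inverse w = reverse (map θ w)

  Reduced : Pred (Word n) 0ℓ
  Reduced w = ∀ u a v → w ≢ u ++ a ∷ θ a ∷ v

  record IsLaminary (S : Pred (Word n) s) : Set s where
    field
      biextendable  : IsBiextendable S
      reduced       : S ⊆ Reduced
      inverseClosed : ∀ {w} → w ∈ S → inverse w ∈ S

  record IsSpecular (S : Pred (Word n) s) : Set (Level.suc s) where
    field
      laminary : IsLaminary S
      treeSet  : IsTreeSet S 2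

infix 4 _⊢_≈_

-- The congruence presenting the group generated by the letters with
-- relations a θ(a) = 1.
data _⊢_≈_ {n : ℕ} (θ : Fin n → Fin n) : Rel (Word n) 0ℓ where
  relator : ∀ a → θ ⊢ a ∷ θ a ∷ [] ≈ []
  ≈-refl  : ∀ {u} → θ ⊢ u ≈ u
  ≈-sym   : ∀ {u v} → θ ⊢ u ≈ v → θ ⊢ v ≈ u
  ≈-trans : ∀ {u v w} → θ ⊢ u ≈ v → θ ⊢ v ≈ w → θ ⊢ u ≈ w
  ++-cong : ∀ {u u′ v v′} → θ ⊢ u ≈ u′ → θ ⊢ v ≈ v′ → θ ⊢ u ++ v ≈ u′ ++ v′

module _ {n : ℕ} (θ : Fin n → Fin n) (θ-inv : Involutive _≡_ θ) where

  private
    _≈_ : Rel (Word n) 0ℓ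
    _≈_ = _⊢_≈_ θ

    ≡⇒≈ : ∀ {u v} → u ≡ v → u ≈ v
    ≡⇒≈ refl = ≈-refl

    relatorˡ : ∀ a → (θ a ∷ a ∷ []) ≈ []
    relatorˡ a = subst (λ b → (θ a ∷ b ∷ []) ≈ []) (θ-inv a) (relator (θ a))

    inverse-∷ : ∀ a w → inverse θ (a ∷ w) ≡ inverse θ w ++ [ θ a ]
    inverse-∷ a w = unfold-reverse (θ a) (map θ w)

    cancel : ∀ u {r} v → r ≈ [] → (u ++ r ++ v) ≈ (u ++ v)
    cancel u v p = ++-cong (≈-refl {u = u}) (++-cong p (≈-refl {u = v}))

    inverseˡ : ∀ w → (inverse θ w ++ w) ≈ []
    inverseˡ []      = ≈-refl
    inverseˡ (a ∷ w) rewrite inverse-∷ a w | ++-assoc (inverse θ w) [ θ a ] (a ∷ w) =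
      ≈-trans (cancel (inverse θ w) w (relatorˡ a)) (inverseˡ w)

    inverseʳ : ∀ w → (w ++ inverse θ w) ≈ []
    inverseʳ []      = ≈-refl
    inverseʳ (a ∷ w) rewrite inverse-∷ a w | sym (++-assoc w (inverse θ w) [ θ a ]) =
      ≈-trans (cancel [ a ] [ θ a ] (inverseʳ w)) (relator a)

    inverse-cong : ∀ {u v} → u ≈ v → inverse θ u ≈ inverse θ v
    inverse-cong {u} {v} p =
      ≈-trans (≈-sym (cancelʳ (inverse θ u) (inverseʳ v)))
      (≈-trans (++-cong (≈-refl {u = inverse θ u}) (++-cong (≈-sym p) ≈-refl))
      (≈-trans (≡⇒≈ (sym (++-assoc (inverse θ u) u (inverse θ v))))
      (++-cong (inverseˡ u) (≈-refl {u = inverse θ v}))))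
      where
      cancelʳ : ∀ u {r} → r ≈ [] → (u ++ r) ≈ u
      cancelʳ u q = ≈-trans (++-cong (≈-refl {u = u}) q) (≡⇒≈ (++-identityʳ u))

  -- Group elements are words up to _⊢_≈_, so a word of S is at the same time
  -- the group element it represents.
  groupOf : Group 0ℓ 0ℓ
  groupOf = record
    { Carrier = Word n
    ; _≈_     = _≈_
    ; _∙_     = _++_
    ; ε       = []
    ; _⁻¹     = inverse θ
    ; isGroup = record
      { isMonoid = record
        { isSemigroup = record
          { isMagma = record
            { isEquivalence = record { refl = ≈-refl ; sym = ≈-sym ; trans = ≈-trans }
            ; ∙-cong        = ++-cong
            }
          ; assoc = λ u v w → ≡⇒≈ (++-assoc u v w)
          }
        ; identity = (λ _ → ≈-refl) , (λ u → ≡⇒≈ (++-identityʳ u))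
        }
      ; inverse = inverseˡ , inverseʳ
      ; ⁻¹-cong = inverse-cong
      }
    }

module _ (G : Group c ℓ) where
  open Group G using (Carrier; _≈_; _∙_; ε; _⁻¹)

  record IsSubgroup (H : Pred Carrier h) : Set (c ⊔ ℓ ⊔ h) where
    field
      resp      : ∀ {g g′} → g ≈ g′ → g ∈ H → g′ ∈ H
      ε-closed  : ε ∈ H
      ∙-closed  : ∀ {g g′} → g ∈ H → g′ ∈ H → (g ∙ g′) ∈ H
      ⁻¹-closed : ∀ {g} → g ∈ H → (g ⁻¹) ∈ H

  -- representative enumerates the right cosets of H without repetition.
  record HasIndex (H : Pred Carrier h) (d : ℕ) : Set (c ⊔ h) where
    field
      representative : Fin d → Carrier
      covering       : ∀ g → ∃ λ i → (g ∙ representative i ⁻¹) ∈ H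
      distinct       : ∀ {i j} → (representative i ∙ representative j ⁻¹) ∈ H → i ≡ j

  HasFiniteIndex : Pred Carrier h → Set (c ⊔ h)
  HasFiniteIndex H = ∃ (HasIndex H)

  product : List Carrier → Carrier
  product = foldr _∙_ ε

  GeneratedMonoid : Pred Carrier x → Pred Carrier (c ⊔ ℓ ⊔ x)
  GeneratedMonoid X g = ∃ λ xs → All X xs × g ≈ product xs

  record IsMonoidalBasis (H : Pred Carrier h) (X : Pred Carrier x) : Set (c ⊔ ℓ ⊔ h ⊔ x) where
    field
      subset        : X ⊆ H
      inverseClosed : ∀ {g} → g ∈ X → (g ⁻¹) ∈ X
      generates     : GeneratedMonoid X ≐ H
      nontrivial    : ∀ {xs} → xs ≢ [] → All X xs → Linked (λ y z → ¬ (y ∙ z ≈ ε)) xs → ¬ (product xs ≈ ε)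

  -- The least subset containing X that is closed under the equality of G.
  Saturation : Pred Carrier x → Pred Carrier (c ⊔ ℓ ⊔ x)
  Saturation X g = ∃ λ y → y ∈ X × y ≈ g

record IsPrimeWord {n : ℕ} (S : Pred (Word n) s) (H : Pred (Word n) h) (w : Word n) : Set (s ⊔ h) where
  field
    nonempty : w ≢ []
    member   : w ∈ H ∩ S
    prime    : ∀ u v → w ≡ u ++ v → u ≢ [] → v ≢ [] → ¬ (u ∈ H ∩ S)

{-# OPTIONS --safe #-}
module Submission where

open import Defs
open import Algebra.Bundles using (Group; CommutativeRing)
open import Algebra.Definitions using (Involutive)
open import Data.Bool.Base using (Bool; true; false; not; _xor_)
open import Data.Bool.Properties using (xor-∧-commutativeRing)
open import Data.Empty using (⊥; ⊥-elim)
open import Data.Fin.Base using (Fin; zero; suc; combine; remQuot; finToFun; funToFin; toℕ)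
import Data.Fin.Properties as Fin
open import Data.List.Base using (List; []; _∷_; _++_; [_]; _∷ʳ_; length; lookup; map; reverse; InitLast; initLast; _∷ʳ′_)
open import Data.List.Membership.Propositional using () renaming (_∈_ to _∈ˡ_)
open import Data.List.Membership.Propositional.Properties using (∈-∃++; ∈-lookup)
open import Data.List.Properties using (++-assoc; ++-identityʳ; length-++; length-map; length-reverse; map-++; reverse-++; unfold-reverse; ≡-dec; ∷-injectiveʳ; ∷ʳ-injective)
open import Data.List.Relation.Unary.All using (All; []; _∷_)
import Data.List.Relation.Unary.All as All
import Data.List.Relation.Unary.All.Properties as All
open import Data.List.Relation.Unary.AllPairs using ([]; _∷_)
open import Data.List.Relation.Unary.Any using (here; there; any?)
open import Data.List.Relation.Unary.Linked using (Linked; []; [-]; _∷_)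
import Data.List.Relation.Unary.Linked as Linked
open import Data.List.Relation.Unary.Unique.Propositional using (Unique)
open import Data.Nat.Base as ℕ using (ℕ; zero; suc; _≤_; _<_; _^_; z≤n; s≤s)
import Data.Nat.Properties as ℕ
open import Data.Product.Base using (∃; ∃₂; _×_; _,_; proj₁; proj₂)
open import Data.Product.Properties using (×-≡,≡→≡)
open import Data.Sum.Base using (_⊎_; inj₁; inj₂)
import Data.Sum.Properties as Sum
open import Data.Unit.Base using (⊤; tt)
open import Function.Base using (_∘_; case_of_)
open import Level using (Level; _⊔_; 0ℓ)
open import Relation.Binary.Construct.Closure.ReflexiveTransitive using (Star)
import Relation.Binary.Construct.Closure.ReflexiveTransitive as Star
open import Relation.Binary.Definitions using (DecidableEquality; tri<; tri≈; tri>)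
open import Relation.Binary.PropositionalEquality using (_≡_; _≢_; _≗_; refl; sym; trans; cong; cong₂; subst; subst₂; module ≡-Reasoning)
open import Relation.Nullary using (¬_; Dec; yes; no; does)
open import Relation.Nullary.Decidable using (_×-dec_; ¬?; dec-true; dec-false; map′)
open import Relation.Unary using (Pred; _∈_; _⊆_)

-- Read words of S from the trivial coset of H, so that the prime words are the
-- first returns.  Because extension graphs are forests, any assignment of values
-- of a group Γ to finitely many prime words is the restriction of a function of
-- (coset, letter) multiplied along words: starting from values depending on the
-- whole past, the dependence is shortened one letter at a time by potentials on
-- the forests.  As the two trees of the extension graph of the empty word are
-- exchanged by θ, letters can be read in either direction, and one gets a cocycle
-- on the group.  With Γ the permutations of stacks this gives freeness.  With
-- Γ = ℤ₂ it bounds the number of prime words; together with recurrence, every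
-- long word of S then has a prime prefix.  Hence, K being generated by the prime
-- words, the set of cosets K s, for s a suffix of a long word w of S, depends only
-- on a bounded suffix of w, and by connectedness of the extension graphs only on
-- the tree containing its last letter.  Each such set contains K and injects into
-- the cosets of H, so H = K.

private variable
  a c ℓ ℓ′ s h p : Level

-- Walks in a graph, their free reduction, and their weights in a group.

module Walks {V : Set a} (𝒢 : Graph V ℓ) where
  open Graph 𝒢

  private variable
    u v w x : V
    xs ys ps : List V

  -- Indexed by the list of the vertices after the start, so that reductions and weights are
  -- computed on lists and do not depend on proofs of adjacency.
  data Walk : V → List V → V → Set (a ⊔ ℓ) where
    []  : Walk u [] u
    _∷_ : Adjacent u x → Walk x xs v → Walk u (x ∷ xs) v

  fromStar : Star Adjacent u v → ∃ λ xs → Walk u xs v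
  fromStar Star.ε       = [] , []
  fromStar (e Star.◅ p) = let xs , ws = fromStar p in _ ∷ xs , e ∷ ws

  Adjacent-sym : Adjacent u v → Adjacent v u
  Adjacent-sym (p , q , e) = q , p , ∼-sym e

  _++ʷ_ : Walk u xs v → Walk v ys w → Walk u (xs ++ ys) w
  []      ++ʷ q = q
  (e ∷ p) ++ʷ q = e ∷ (p ++ʷ q)

  back : V → List V → List V
  back u []       = []
  back u (x ∷ xs) = back x xs ++ [ u ]

  backʷ : Walk u xs v → Walk v (back u xs) u
  backʷ []      = []
  backʷ (e ∷ p) = backʷ p ++ʷ (Adjacent-sym e ∷ [])

  splitʷ : ∀ ps → Walk u (ps ++ ys) v → ∃ λ m → Walk u ps m × Walk m ys v
  splitʷ []       p       = _ , [] , p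
  splitʷ (x ∷ ps) (e ∷ p) = let m , q , r = splitʷ ps p in m , e ∷ q , r

  last-∷ʳ : ∀ ps → Walk u (ps ∷ʳ w) v → v ≡ w
  last-∷ʳ []       (e ∷ []) = refl
  last-∷ʳ (x ∷ ps) (e ∷ p)  = last-∷ʳ ps p

  last-∈ : Walk u (x ∷ xs) v → v ∈ˡ x ∷ xs
  last-∈ (e ∷ [])         = here refl
  last-∈ (e ∷ p@(_ ∷ _)) = there (last-∈ p)

  toLinked : Walk u xs v → Linked Adjacent (u ∷ xs)
  toLinked []              = [-]
  toLinked (e ∷ [])        = e ∷ [-]
  toLinked (e ∷ p@(_ ∷ _)) = e ∷ toLinked p

  data NonBacktracking : List V → Set a where
    [-]  : NonBacktracking [ u ]
    [-,-] : NonBacktracking (u ∷ v ∷ [])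
    _∷_  : u ≢ w → NonBacktracking (v ∷ w ∷ xs) → NonBacktracking (u ∷ v ∷ w ∷ xs)

  tail-nb : NonBacktracking (u ∷ x ∷ xs) → NonBacktracking (x ∷ xs)
  tail-nb [-,-]  = [-]
  tail-nb (_ ∷ n) = n

  module Reduction (_≟_ : DecidableEquality V) where

    prepend : V → V → List V → List V
    prepend u x []       = [ x ]
    prepend u x (y ∷ ys) with u ≟ y
    ... | yes _ = ys
    ... | no  _ = x ∷ y ∷ ys

    -- Free reduction, performed from the far end: every step out and straight back is cancelled.
    reduce : V → List V → List V
    reduce u []       = []
    reduce u (x ∷ xs) = prepend u x (reduce x xs)

    prepend-walk : Adjacent u x → Walk x xs v → Walk u (prepend u x xs) v
    prepend-walk e [] = e ∷ []
    prepend-walk {u = u} {xs = y ∷ _} e (f ∷ p) with u ≟ y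
    ... | yes refl = p
    ... | no  _    = e ∷ f ∷ p

    reduce-walk : Walk u xs v → Walk u (reduce u xs) v
    reduce-walk []      = []
    reduce-walk (e ∷ p) = prepend-walk e (reduce-walk p)

    prepend-nb : ∀ u x xs → NonBacktracking (x ∷ xs) → NonBacktracking (u ∷ prepend u x xs)
    prepend-nb u x []       n = [-,-]
    prepend-nb u x (y ∷ ys) n with u ≟ y
    ... | yes refl = tail-nb n
    ... | no  u≢y  = u≢y ∷ n

    reduce-nb : ∀ u xs → NonBacktracking (u ∷ reduce u xs)
    reduce-nb u []       = [-]
    reduce-nb u (x ∷ xs) = prepend-nb u x (reduce x xs) (reduce-nb x xs)

    rotate-unique : ∀ ps → Unique (ps ++ u ∷ ys) → Unique (u ∷ ps)
    rotate-unique []       uq        = [] ∷ []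
    rotate-unique (p ∷ ps) (p∉ ∷ uq) with rotate-unique ps uq
    ... | u∉ ∷ uq′ = ((λ u≡p → All.head (All.++⁻ʳ ps p∉) (sym u≡p)) ∷ u∉) ∷ (All.++⁻ˡ ps p∉ ∷ uq′)

    module Acyclic (irrefl : ∀ {v} → ¬ Adjacent v v) (acyclic : ¬ Cycle) where

      -- By induction the tail has no repetition. If `u` recurs in it, irreflexivity excludes the
      -- next vertex, the absence of backtracking excludes the one after, and a later recurrence
      -- closes a cycle.
      nb-unique : Walk u xs v → NonBacktracking (u ∷ xs) → Unique (u ∷ xs)
      nb-unique [] _ = [] ∷ []
      nb-unique {u = u} (_∷_ {x = x} {xs = xs} e p) n with any? (u ≟_) (x ∷ xs)
      ... | no  u∉ = All.¬Any⇒All¬ _ u∉ ∷ nb-unique p (tail-nb n)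
      ... | yes (here refl) = ⊥-elim (irrefl e)
      ... | yes (there u∈) with ∈-∃++ u∈
      ...   | ps , post , eq with initLast ps
      nb-unique {u = u} (_∷_ {x = x} e p) (u≢u ∷ _) | yes (there u∈) | .[] , post , refl | [] = ⊥-elim (u≢u refl)
      nb-unique {u = u} (_∷_ {x = x} e p) n | yes (there u∈) | .(vs ∷ʳ z) , post , refl | vs ∷ʳ′ z
        with splitʷ (vs ∷ʳ z) p
      ... | m , q , f ∷ r with last-∷ʳ vs q
      ... | refl = ⊥-elim (acyclic record
        { u = u ; w = z ; vs = x ∷ vs ; long = λ ()
        ; distinct = rotate-unique (x ∷ vs ∷ʳ z) (nb-unique p (tail-nb n))
        ; path = toLinked (e ∷ q) ; closing = f })

      nb-closed : Walk u xs u → NonBacktracking (u ∷ xs) → xs ≡ []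
      nb-closed [] _ = refl
      nb-closed p@(_ ∷ _) n with nb-unique p n
      ... | u∉ ∷ _ = ⊥-elim (All.lookup u∉ (last-∈ p) refl)

      -- The reduced walk has no repeated vertex. If it is a single step, that step is the edge; if
      -- it is longer, an edge between its ends would close it to a cycle.
      adjacent? : Walk u xs v → Dec (Adjacent u v)
      adjacent? {u = u} {xs = xs} {v = v} p = go (initLast (reduce u xs)) (reduce-walk p) (reduce-nb u xs)
        where
        go : ∀ {ys} → InitLast ys → Walk u ys v → NonBacktracking (u ∷ ys) → Dec (Adjacent u v)
        go []         []       _ = no irrefl
        go ([] ∷ʳ′ z) (e ∷ []) _ = yes e
        go (vs@(_ ∷ _) ∷ʳ′ z) q n with last-∷ʳ vs q
        ... | refl = no λ e → acyclic record
          { u = u ; w = v ; vs = vs ; long = λ ()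
          ; distinct = nb-unique q n ; path = toLinked q ; closing = Adjacent-sym e }

      module Weights (Γ : Group c ℓ′) (ω : V → V → Group.Carrier Γ)
                     (ω-anti : ∀ u v → Group._≈_ Γ (Group._∙_ Γ (ω u v) (ω v u)) (Group.ε Γ)) where
        open Group Γ renaming (ε to 1#; refl to ≈refl; sym to ≈sym; trans to ≈trans) hiding (_⁻¹)
        open Group Γ using (_⁻¹)
        open import Algebra.Properties.Group Γ
        open import Relation.Binary.Reasoning.Setoid setoid

        weight : V → List V → Carrier
        weight u []       = 1#
        weight u (x ∷ xs) = ω u x ∙ weight x xs

        weight-++ : Walk u xs v → ∀ ys → weight u (xs ++ ys) ≈ weight u xs ∙ weight v ys
        weight-++ []      ys = ≈sym (identityˡ _)
        weight-++ (e ∷ p) ys = ≈trans (∙-congˡ (weight-++ p ys)) (≈sym (assoc _ _ _))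

        weight-back : Walk u xs v → weight v (back u xs) ≈ weight u xs ⁻¹
        weight-back [] = ≈sym ε⁻¹≈ε
        weight-back {u = u} (_∷_ {x = x} {xs = xs} {v = v} e p) = begin
          weight v (back x xs ++ [ u ])        ≈⟨ weight-++ (backʷ p) [ u ] ⟩
          weight v (back x xs) ∙ (ω x u ∙ 1#)  ≈⟨ ∙-cong (weight-back p) (≈trans (identityʳ _) (inverseˡ-unique _ _ (ω-anti x u))) ⟩
          weight x xs ⁻¹ ∙ ω u x ⁻¹            ≈⟨ ⁻¹-anti-homo-∙ _ _ ⟨
          (ω u x ∙ weight x xs) ⁻¹             ∎

        weight-reduce : ∀ u xs → weight u (reduce u xs) ≈ weight u xs
        weight-reduce u []       = ≈refl
        weight-reduce u (x ∷ xs) = ≈trans (lemma (reduce x xs)) (∙-congˡ (weight-reduce x xs))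
          where
          lemma : ∀ ys → weight u (prepend u x ys) ≈ ω u x ∙ weight x ys
          lemma []       = ≈refl
          lemma (y ∷ ys) with u ≟ y
          ... | no _ = ≈refl
          ... | yes refl = begin
            weight u ys                     ≈⟨ identityˡ _ ⟨
            1# ∙ weight u ys                ≈⟨ ∙-congʳ (ω-anti u x) ⟨
            (ω u x ∙ ω x u) ∙ weight u ys   ≈⟨ assoc _ _ _ ⟩
            ω u x ∙ (ω x u ∙ weight u ys)   ∎

        -- Reduction preserves weights because `ω` is antisymmetric, and without cycles a closed
        -- walk reduces to the trivial one.
        weight-closed : Walk u xs u → weight u xs ≈ 1#
        weight-closed {u = u} {xs = xs} p = ≈trans (≈sym (weight-reduce u xs))
          (reflexive (cong (weight u) (nb-closed (reduce-walk p) (reduce-nb u xs))))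

        weight-unique : Walk u xs v → Walk u ys v → weight u xs ≈ weight u ys
        weight-unique {u = u} {xs = xs} {ys = ys} p q = x∙y⁻¹≈ε⇒x≈y _ _ (begin
          weight u xs ∙ weight u ys ⁻¹       ≈⟨ ∙-congˡ (weight-back q) ⟨
          weight u xs ∙ weight _ (back u ys) ≈⟨ weight-++ p _ ⟨
          weight u (xs ++ back u ys)         ≈⟨ weight-closed (p ++ʷ backʷ q) ⟩
          1# ∎)

-- The chosen roots and walks make it decidable whether two vertices lie in the same tree, and give
-- potentials a base point in each tree.
record IsRootedForest {V : Set a} (𝒢 : Graph V ℓ) : Set (a ⊔ ℓ) where
  open Graph 𝒢
  open Walks 𝒢
  field
    irrefl  : ∀ {v} → ¬ Adjacent v v
    acyclic : ¬ Cycle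
    root    : V → V
    fromRoot : ∀ {v} → v ∈ Vertex → ∃ λ xs → Walk (root v) xs v
    root-adjacent : ∀ {u v} → Adjacent u v → root u ≡ root v

  adjacentVertices? : DecidableEquality V → ∀ {u v} → u ∈ Vertex → v ∈ Vertex → Dec (Adjacent u v)
  adjacentVertices? _≟_ {u} {v} u∈ v∈ with root u ≟ root v | fromRoot u∈ | fromRoot v∈
  ... | no  r≢ | _      | _      = no (r≢ ∘ root-adjacent)
  ... | yes r≡ | xs , p | ys , q =
    Reduction.Acyclic.adjacent? _≟_ irrefl acyclic (backʷ p ++ʷ subst (λ r → Walk r ys v) (sym r≡) q)

-- Extension graphs of a tree set as forests; decidability of the set; potentials.

module TreeSet {n k} (S : Pred (Word n) s) (treeSet : IsTreeSet S (suc k)) where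
  open IsTreeSet treeSet
  open IsBiextendable biextendable using (factorial; extendable) public
  open IsFactorial factorial public
  open IsDisjointUnionOfTrees emptyWord

  V : Set
  V = Fin n ⊎ Fin n

  _≟ⱽ_ : DecidableEquality V
  _≟ⱽ_ = Sum.≡-dec Fin._≟_ Fin._≟_

  prefix∈ : ∀ u v → u ++ v ∈ S → u ∈ S
  prefix∈ u v = factors [] u v

  suffix∈ : ∀ u v → u ++ v ∈ S → v ∈ S
  suffix∈ u v p = factors u v [] (subst (λ z → u ++ z ∈ S) (sym (++-identityʳ v)) p)

  letter-vertex : ∀ v → ExtVertex S [] v
  letter-vertex (inj₁ a) = left (letters a)
  letter-vertex (inj₂ b) = right (letters b)

  ℰ : Word n → Graph V s
  ℰ = extensionGraph S

  component : V → Fin (suc k)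
  component v = proj₁ (covering (letter-vertex v))

  component-part : ∀ v → v ∈ part (component v)
  component-part v = proj₂ (covering (letter-vertex v))

  component-adjacent : ∀ {u v} → Graph.Adjacent (ℰ []) u v → component u ≡ component v
  component-adjacent {u} {v} e = disjoint (noCross e (component-part u)) (component-part v)

  component-edge : ∀ {a b} → a ∷ b ∷ [] ∈ S → component (inj₁ a) ≡ component (inj₂ b)
  component-edge p = component-adjacent (letter-vertex _ , letter-vertex _ , edge p)

  component-walk : ∀ {u v} → component u ≡ component v → ∃ λ xs → Walks.Walk (ℰ []) u xs v
  component-walk {u} {v} eq = Walks.fromStar (ℰ []) (Star.map forget
    (Graph.IsTree.connected (trees (component u)) (letter-vertex u , component-part u)
      (letter-vertex v , subst (λ i → v ∈ part i) (sym eq) (component-part v))))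
    where
    forget : ∀ {x y} → Graph.Adjacent (induced (ℰ []) (part (component u))) x y → Graph.Adjacent (ℰ []) x y
    forget ((p , _) , (q , _) , e) = p , q , e

  nonempty-walk : ∀ {w} → w ∈ S → w ≢ [] → ∀ {u v} → ExtVertex S w u → ExtVertex S w v →
                  ∃ λ xs → Walks.Walk (ℰ w) u xs v
  nonempty-walk w∈ w≢ p q = Walks.fromStar (ℰ _) (Graph.IsTree.connected (nonemptyWord w∈ w≢) p q)

  -- No edge leaves a part, so a cycle stays in the part of its first vertex and contradicts that
  -- this part is a tree.
  empty-acyclic : ¬ Graph.Cycle (ℰ [])
  empty-acyclic cyc = Graph.IsTree.acyclic (trees (component u)) record
    { u = u ; w = w ; vs = vs ; long = long ; distinct = distinct
    ; path = restrict path (component-part u)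
    ; closing = (proj₁ closing , noCross (Walks.Adjacent-sym (ℰ []) closing) (component-part u))
              , (proj₁ (proj₂ closing) , component-part u) , proj₂ (proj₂ closing) }
    where
    open Graph.Cycle cyc
    restrict : ∀ {i x xs} → Linked (Graph.Adjacent (ℰ [])) (x ∷ xs) → x ∈ part i →
               Linked (Graph.Adjacent (induced (ℰ []) (part i))) (x ∷ xs)
    restrict [-] _ = [-]
    restrict (e@(p , q , r) ∷ es) x∈ = let y∈ = noCross e x∈ in
      ((p , x∈) , (q , y∈) , r) ∷ restrict es y∈

  ℰ-irrefl : ∀ {w v} → ¬ Graph.Adjacent (ℰ w) v v
  ℰ-irrefl (_ , _ , ())

  ℰ-forest : ∀ {w} → w ∈ S → IsRootedForest (ℰ w)
  ℰ-forest {[]} _ = record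
    { irrefl = ℰ-irrefl
    ; acyclic = empty-acyclic
    ; root = r ∘ component
    ; fromRoot = λ {v} _ → component-walk (r-component (component v))
    ; root-adjacent = cong r ∘ component-adjacent }
    where
    r : Fin (suc k) → V
    r i = proj₁ (Graph.IsTree.nonempty (trees i))
    r-component : ∀ i → component (r i) ≡ i
    r-component i = disjoint (component-part (r i)) (proj₂ (proj₂ (Graph.IsTree.nonempty (trees i))))
  ℰ-forest {_ ∷ _} w∈ = record
    { irrefl = ℰ-irrefl
    ; acyclic = Graph.IsTree.acyclic (nonemptyWord w∈ (λ ()))
    ; root = λ _ → proj₁ nonempty
    ; fromRoot = λ p → nonempty-walk w∈ (λ ()) (proj₂ nonempty) p
    ; root-adjacent = λ _ → refl }
    where open Graph.IsTree (nonemptyWord w∈ (λ ())) using (nonempty)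

  someLetter : Fin n
  someLetter with Graph.IsTree.nonempty (trees zero)
  ... | inj₁ a , _ = a
  ... | inj₂ a , _ = a

  []∈ : [] ∈ S
  []∈ = prefix∈ [] [ someLetter ] (letters someLetter)

  -- An edge of a forest between two given vertices can be decided, since a
  -- path of length at least 2 between them excludes it.
  infix 4 _∈S?
  _∈S? : ∀ w → Dec (w ∈ S)
  w ∈S? = go (length w) w ℕ.≤-refl
    where
    go : ∀ m w → length w ≤ m → Dec (w ∈ S)
    goʳ : ∀ m a {w} → InitLast w → length w ≤ m → Dec (a ∷ w ∈ S)
    go _       []      _       = yes []∈
    go (suc m) (a ∷ w) (s≤s l) = goʳ m a (initLast w) l
    goʳ m a []        _ = yes (letters a)
    goʳ (suc m) a (w ∷ʳ′ b) l = decide (go (suc m) (a ∷ w) (s≤s |w|≤m)) (go (suc m) (w ∷ʳ b) l)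
      where
      |w|≤m : length w ≤ m
      |w|≤m = ℕ.≤-pred (subst (_≤ suc m) (trans (length-++ w) (ℕ.+-comm (length w) 1)) l)
      decide : Dec (a ∷ w ∈ S) → Dec (w ∷ʳ b ∈ S) → Dec (a ∷ w ∷ʳ b ∈ S)
      decide (no aw∉) _         = no (aw∉ ∘ prefix∈ (a ∷ w) [ b ])
      decide _        (no wb∉)  = no (wb∉ ∘ suffix∈ [ a ] (w ∷ʳ b))
      decide (yes aw∈) (yes wb∈) = map′ (λ { (_ , _ , edge p) → p }) (λ p → left aw∈ , right wb∈ , edge p)
        (IsRootedForest.adjacentVertices? (ℰ-forest (suffix∈ [ a ] w aw∈)) _≟ⱽ_ (left aw∈) (right wb∈))
    goʳ zero a ([] ∷ʳ′ b) ()
    goʳ zero a ((_ ∷ _) ∷ʳ′ b) ()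

  module _ (Γ : Group c ℓ′) where
    open Group Γ renaming (ε to 1#; sym to ≈sym; trans to ≈trans; refl to ≈refl)

    Potentials : Word n → (Fin n → Fin n → Carrier) → Set _
    Potentials w m = ∃₂ λ (l r : Fin n → Carrier) → ∀ a b → a ∷ w ++ [ b ] ∈ S → l a ∙ m a b ≈ r b

    -- Every edge labelling of a forest is a coboundary: the potential of a vertex is the weight of
    -- the walk to it from its root. An edge prolongs the walk to `a` to a walk to `b`, and weights
    -- depend on the ends only.
    potentials : ∀ w m → Potentials w m
    potentials w m with w ∈S?
    -- Outside `S` there are no edges, and any potentials will do.
    ... | no  w∉ = (λ _ → 1#) , (λ _ → 1#) , λ a b p → ⊥-elim (w∉ (factors [ a ] w [ b ] p))
    ... | yes w∈ = pot ∘ inj₁ , pot ∘ inj₂ , correct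
      where
      open IsRootedForest (ℰ-forest w∈)
      open Walks (ℰ w)

      ω : V → V → Carrier
      ω (inj₁ a) (inj₂ b) = m a b
      ω (inj₂ b) (inj₁ a) = m a b ⁻¹
      ω (inj₁ _) (inj₁ _) = 1#
      ω (inj₂ _) (inj₂ _) = 1#

      ω-anti : ∀ u v → ω u v ∙ ω v u ≈ 1#
      ω-anti (inj₁ a) (inj₂ b) = inverseʳ _
      ω-anti (inj₂ b) (inj₁ a) = inverseˡ _
      ω-anti (inj₁ _) (inj₁ _) = identityˡ _
      ω-anti (inj₂ _) (inj₂ _) = identityˡ _

      open Reduction.Acyclic.Weights _≟ⱽ_ irrefl acyclic Γ ω ω-anti

      vertex? : ∀ v → Dec (ExtVertex S w v)
      vertex? (inj₁ a) = map′ left (λ { (left p) → p }) (a ∷ w ∈S?)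
      vertex? (inj₂ b) = map′ right (λ { (right p) → p }) (w ++ [ b ] ∈S?)

      potOf : ∀ {v} → Dec (ExtVertex S w v) → Carrier
      potOf {v} (yes p) = weight (root v) (proj₁ (fromRoot p))
      potOf     (no _)  = 1#

      pot : V → Carrier
      pot v = potOf (vertex? v)

      correct : ∀ a b → a ∷ w ++ [ b ] ∈ S → pot (inj₁ a) ∙ m a b ≈ pot (inj₂ b)
      correct a b p = lemma (vertex? (inj₁ a)) (vertex? (inj₂ b))
        where
        lemma : (d : Dec (ExtVertex S w (inj₁ a))) (e : Dec (ExtVertex S w (inj₂ b))) → potOf d ∙ m a b ≈ potOf e
        lemma (no a∉)  _        = ⊥-elim (a∉ (left (prefix∈ (a ∷ w) [ b ] p)))
        lemma (yes _)  (no b∉)  = ⊥-elim (b∉ (right (suffix∈ [ a ] (w ++ [ b ]) p)))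
        lemma (yes a∈) (yes b∈) with fromRoot a∈ | fromRoot b∈
        ... | xs , q | ys , r =
          ≈trans (∙-congˡ (≈sym (identityʳ _)))
          (≈trans (≈sym (weight-++ q [ inj₂ b ]))
          (≈trans (weight-unique (q ++ʷ ((a∈ , b∈ , edge p) ∷ [])) (subst (λ z → Walk z ys (inj₂ b)) (sym r≡) r))
          (reflexive (cong (λ z → weight z ys) r≡))))
          where
          r≡ : root (inj₁ a) ≡ root (inj₂ b)
          r≡ = root-adjacent (a∈ , b∈ , edge p)

length-∷ʳ : ∀ {A : Set a} (xs : List A) x → length (xs ∷ʳ x) ≡ suc (length xs)
length-∷ʳ xs x = trans (length-++ xs) (ℕ.+-comm (length xs) 1)

-- Words acting on a set: products along orbits, and first returns to a point.

module Action {n} {Q : Set} (_·_ : Q → Fin n → Q) where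

  infixl 5 _▷_
  _▷_ : Q → Word n → Q
  q ▷ []      = q
  q ▷ (a ∷ w) = (q · a) ▷ w

  ▷-++ : ∀ q u v → q ▷ (u ++ v) ≡ q ▷ u ▷ v
  ▷-++ q []      v = refl
  ▷-++ q (a ∷ u) v = ▷-++ (q · a) u v

  module Values (Γ : Group c ℓ′) where
    open Group Γ renaming (ε to 1#; sym to ≈sym; trans to ≈trans; refl to ≈refl)

    productAlong : (Q → Fin n → Carrier) → Q → Word n → Carrier
    productAlong φ q []      = 1#
    productAlong φ q (b ∷ w) = φ q b ∙ productAlong φ (q · b) w

    productAlong-++ : ∀ φ q u v → productAlong φ q (u ++ v) ≈ productAlong φ q u ∙ productAlong φ (q ▷ u) v
    productAlong-++ φ q []      v = ≈sym (identityˡ _)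
    productAlong-++ φ q (a ∷ u) v = ≈trans (∙-congˡ (productAlong-++ φ (q · a) u v)) (≈sym (assoc _ _ _))

  module _ (θ : Fin n → Fin n) (·-θ : ∀ q a → (q · a) · θ a ≡ q) where

    ▷-resp : ∀ {u v} → θ ⊢ u ≈ v → ∀ q → q ▷ u ≡ q ▷ v
    ▷-resp (relator a)   q = ·-θ q a
    ▷-resp ≈-refl        q = refl
    ▷-resp (≈-sym e)     q = sym (▷-resp e q)
    ▷-resp (≈-trans e f) q = trans (▷-resp e q) (▷-resp f q)
    ▷-resp (++-cong {u} {u′} {v} {v′} e f) q = begin
      q ▷ (u ++ v)   ≡⟨ ▷-++ q u v ⟩
      q ▷ u ▷ v      ≡⟨ cong (_▷ v) (▷-resp e q) ⟩
      q ▷ u′ ▷ v     ≡⟨ ▷-resp f (q ▷ u′) ⟩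
      q ▷ u′ ▷ v′    ≡⟨ ▷-++ q u′ v′ ⟨
      q ▷ (u′ ++ v′) ∎
      where open ≡-Reasoning

    module _ (Γ : Group c ℓ′) (φ : Q → Fin n → Group.Carrier Γ)
             (φ-θ : ∀ q a → Group._≈_ Γ (Group._∙_ Γ (φ q a) (φ (q · a) (θ a))) (Group.ε Γ)) where
      open Group Γ using (_≈_; _∙_; ∙-cong; ∙-congˡ; identityʳ; reflexive; setoid) renaming (sym to ≈ˢ; trans to ≈ᵗ; refl to ≈ʳ)
      open Values Γ

      -- By `φ-θ` every relator has product 1 from every state, so the product along words is a
      -- cocycle on the group with relations `a θ(a) = 1`.
      productAlong-resp : ∀ {u v} → θ ⊢ u ≈ v → ∀ q → productAlong φ q u ≈ productAlong φ q v
      productAlong-resp (relator a)   q = ≈ᵗ (∙-congˡ (identityʳ _)) (φ-θ q a)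
      productAlong-resp ≈-refl        q = ≈ʳ
      productAlong-resp (≈-sym e)     q = ≈ˢ (productAlong-resp e q)
      productAlong-resp (≈-trans e f) q = ≈ᵗ (productAlong-resp e q) (productAlong-resp f q)
      productAlong-resp (++-cong {u} {u′} {v} {v′} e f) q = begin
        productAlong φ q (u ++ v)                           ≈⟨ productAlong-++ φ q u v ⟩
        productAlong φ q u ∙ productAlong φ (q ▷ u) v       ≈⟨ ∙-cong (productAlong-resp e q) (productAlong-resp f (q ▷ u)) ⟩
        productAlong φ q u′ ∙ productAlong φ (q ▷ u) v′     ≈⟨ ∙-congˡ (reflexive (cong (λ z → productAlong φ z v′) (▷-resp e q))) ⟩
        productAlong φ q u′ ∙ productAlong φ (q ▷ u′) v′    ≈⟨ productAlong-++ φ q u′ v′ ⟨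
        productAlong φ q (u′ ++ v′)                         ∎
        where open import Relation.Binary.Reasoning.Setoid setoid

module PointedAction {n} {Q : Set} (_·_ : Q → Fin n → Q) (∗ : Q) where
  open Action _·_ public

  data FirstReturn : Q → Word n → Set where
    done : ∀ {q b} → q · b ≡ ∗ → FirstReturn q [ b ]
    step : ∀ {q b w} → q · b ≢ ∗ → FirstReturn (q · b) w → FirstReturn q (b ∷ w)

  Avoids : Q → Word n → Set
  Avoids q []      = q ≢ ∗
  Avoids q (a ∷ w) = q ≢ ∗ × Avoids (q · a) w

  -- The starting state is exempt, since prime words are read from `∗` itself.
  Avoids⁺ : Q → Word n → Set
  Avoids⁺ q []      = ⊤
  Avoids⁺ q (a ∷ w) = Avoids (q · a) w

  avoids-head : ∀ {q} w → Avoids q w → q ≢ ∗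
  avoids-head []      p = p
  avoids-head (_ ∷ _) p = proj₁ p

  avoids⁺ : ∀ {q} w → Avoids q w → Avoids⁺ q w
  avoids⁺ []      p = tt
  avoids⁺ (_ ∷ _) p = proj₂ p

  avoids-∷ʳ : ∀ {q} w {b} → Avoids q w → (q ▷ w) · b ≢ ∗ → Avoids q (w ∷ʳ b)
  avoids-∷ʳ []      p       e = p , e
  avoids-∷ʳ (_ ∷ w) (p , r) e = p , avoids-∷ʳ w r e

  avoids⁺-∷ʳ : ∀ {q} w {b} → Avoids⁺ q w → (q ▷ w) · b ≢ ∗ → Avoids⁺ q (w ∷ʳ b)
  avoids⁺-∷ʳ []      _ e = e
  avoids⁺-∷ʳ (_ ∷ w) p e = avoids-∷ʳ w p e

  firstReturn-returns : ∀ {q w} → FirstReturn q w → q ▷ w ≡ ∗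
  firstReturn-returns (done e)    = e
  firstReturn-returns (step _ fr) = firstReturn-returns fr

  firstReturn-≢[] : ∀ {q w} → FirstReturn q w → w ≢ []
  firstReturn-≢[] (done _)   ()
  firstReturn-≢[] (step _ _) ()

  firstReturn-first : ∀ {q w} → FirstReturn q w → ∀ u v → w ≡ u ++ v → u ≢ [] → v ≢ [] → q ▷ u ≢ ∗
  firstReturn-first _           []          v _    u≢ _  = ⊥-elim (u≢ refl)
  firstReturn-first (done _)    (_ ∷ [])    [] _   _  v≢ = ⊥-elim (v≢ refl)
  firstReturn-first (step ¬e _) (_ ∷ [])    v refl _  _  = ¬e
  firstReturn-first (step _ fr) (_ ∷ c ∷ u) v refl _  v≢ = firstReturn-first fr (c ∷ u) v refl (λ ()) v≢

  mkFirstReturn : ∀ {q} w → w ≢ [] → q ▷ w ≡ ∗ → (∀ u v → w ≡ u ++ v → u ≢ [] → v ≢ [] → q ▷ u ≢ ∗) → FirstReturn q w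
  mkFirstReturn []          w≢ _ _ = ⊥-elim (w≢ refl)
  mkFirstReturn (a ∷ [])    _  e _ = done e
  mkFirstReturn (a ∷ b ∷ w) _  e f = step (f [ a ] (b ∷ w) refl (λ ()) (λ ()))
    (mkFirstReturn (b ∷ w) (λ ()) e (λ u v eq _ v≢ → f (a ∷ u) v (cong (a ∷_) eq) (λ ()) v≢))

  prepend-avoiding : ∀ {q} w {u} → Avoids q w → FirstReturn (q ▷ w) u → FirstReturn q (w ++ u)
  prepend-avoiding []      _        fr = fr
  prepend-avoiding (a ∷ w) (_ , av) fr = step (avoids-head w av) (prepend-avoiding w av fr)

  prepend-avoiding⁺ : ∀ {q} w {u} → Avoids⁺ q w → FirstReturn (q ▷ w) u → FirstReturn q (w ++ u)
  prepend-avoiding⁺ []      _  fr = fr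
  prepend-avoiding⁺ (a ∷ w) av fr = step (avoids-head w av) (prepend-avoiding w av fr)

  avoids-last : ∀ {q} w → Avoids q w → q ▷ w ≢ ∗
  avoids-last []      p       = p
  avoids-last (_ ∷ w) (_ , p) = avoids-last w p

  avoids⁺-last : ∀ {q} w → w ≢ [] → Avoids⁺ q w → q ▷ w ≢ ∗
  avoids⁺-last []      w≢ _ = ⊥-elim (w≢ refl)
  avoids⁺-last (_ ∷ w) _  p = avoids-last w p

  module _ (_≟_ : DecidableEquality Q) where

    firstReturn : ∀ q w → w ≢ [] → q ▷ w ≡ ∗ → ∃₂ λ u v → w ≡ u ++ v × FirstReturn q u
    firstReturn q []      w≢ _ = ⊥-elim (w≢ refl)
    firstReturn q (a ∷ w) _  e with (q · a) ≟ ∗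
    ... | yes p = [ a ] , w , refl , done p
    ... | no ¬p with firstReturn (q · a) w (λ { refl → ¬p e }) e
    ...   | u , v , refl , fr = a ∷ u , v , refl , step ¬p fr

    avoids? : ∀ q w → Dec (Avoids q w)
    avoids? q []      = ¬? (q ≟ ∗)
    avoids? q (a ∷ w) = ¬? (q ≟ ∗) ×-dec avoids? (q · a) w

    avoids⁺? : ∀ q w → Dec (Avoids⁺ q w)
    avoids⁺? q []      = yes tt
    avoids⁺? q (a ∷ w) = avoids? (q · a) w

    ¬avoids⇒firstReturn : ∀ q w → ¬ Avoids⁺ q w → ∃₂ λ u v → w ≡ u ++ v × FirstReturn q u
    ¬avoids⇒firstReturn q []      ¬av = ⊥-elim (¬av tt)
    ¬avoids⇒firstReturn q (a ∷ w) ¬av with (q · a) ≟ ∗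
    ... | yes p = [ a ] , w , refl , done p
    ... | no ¬p with ¬avoids⇒firstReturn (q · a) w (¬av ∘ cons w)
      where
      cons : ∀ w → Avoids⁺ (q · a) w → Avoids (q · a) w
      cons []      _  = ¬p
      cons (_ ∷ _) av = ¬p , av
    ...   | u , v , refl , fr = a ∷ u , v , refl , step ¬p fr

-- Extending values on first returns to products of values of steps.

-- Reading a word from ∗, the states are contexts (q , w): the last letters w
-- read, at most m of them, with the point q where they start.  At level m the
-- value of a step depends on the context only; lowering m merges the contexts
-- a w and w, which is possible after a change of gauge by the potentials of
-- the extension graph of w.
module Extension {n k} (S : Pred (Word n) s) (treeSet : IsTreeSet S (suc k))
  {Q : Set} (_≟_ : DecidableEquality Q) (_·_ : Q → Fin n → Q) (∗ : Q)
  (θ : Fin n → Fin n) (·-θ : ∀ q a → (q · a) · θ a ≡ q) (Γ : Group c ℓ′) where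

  open TreeSet S treeSet
  open PointedAction _·_ ∗
  open Values Γ
  open Group Γ renaming (ε to 1#; sym to ≈sym; trans to ≈trans; refl to ≈refl)
  open import Relation.Binary.Reasoning.Setoid setoid

  Step : Set c
  Step = Q → Word n → Fin n → Carrier

  -- Truncation to `m` letters of a context with at most `m + 1`: the oldest letter is dropped, and
  -- the starting point moves along it.
  slide : ℕ → Q → Word n → Q × Word n
  slide m q []      = q , []
  slide m q (c ∷ w) with length w ℕ.<? m
  ... | yes _ = q , c ∷ w
  ... | no  _ = q · c , w

  slide-short : ∀ {m} q w → length w ≤ m → slide m q w ≡ (q , w)
  slide-short     q []      _ = refl
  slide-short {m} q (c ∷ w) p with length w ℕ.<? m
  ... | yes _ = refl
  ... | no ¬p = ⊥-elim (¬p p)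

  slide-long : ∀ {m} q c w → length w ≡ m → slide m q (c ∷ w) ≡ (q · c , w)
  slide-long {m} q c w e with length w ℕ.<? m
  ... | yes p = ⊥-elim (ℕ.<-irrefl e p)
  ... | no _  = refl

  run : ℕ → Step → Q × Word n → Word n → Carrier
  run m μ _       []      = 1#
  run m μ (q , w) (b ∷ y) = μ q w b ∙ run m μ (slide m q (w ∷ʳ b)) y

  module Lower (m : ℕ) (μ : Step) where

    -- By `·-θ`, the contexts `(p · θ a , a ∷ w)` are exactly those that become `(p , w)` when their
    -- oldest letter `a` is dropped; their values are the edge labels in the extension graph of `w`.
    potential : ∀ p w → Potentials Γ w (λ a b → μ (p · θ a) (a ∷ w) b)
    potential p w = potentials Γ w _

    l r : Step
    l p w = proj₁ (potential p w)
    r p w = proj₁ (proj₂ (potential p w))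

    l-r : ∀ q a w b → a ∷ w ∷ʳ b ∈ S → l (q · a) w a ∙ μ q (a ∷ w) b ≈ r (q · a) w b
    l-r q a w b p = ≈trans (∙-congˡ (reflexive (cong (λ z → μ z (a ∷ w) b) (sym (·-θ q a)))))
                           (proj₂ (proj₂ (potential (q · a) w)) a b p)

    -- The change of gauge on arriving in a context. It is trivial where no letter is dropped, and
    -- at a return to `∗`, where no later step could compensate it.
    gauge : Q → Word n → Carrier
    gauge q []      = 1#
    gauge q (c ∷ w) with length w ℕ.<? m | (q ▷ (c ∷ w)) ≟ ∗
    ... | yes _ | _     = 1#
    ... | no _  | yes _ = 1#
    ... | no _  | no _  = l (q · c) w c ⁻¹

    gauge-short : ∀ q w → length w ≤ m → gauge q w ≡ 1#
    gauge-short q []      _ = refl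
    gauge-short q (c ∷ w) p with length w ℕ.<? m | (q ▷ (c ∷ w)) ≟ ∗
    ... | yes _ | _ = refl
    ... | no ¬p | _ = ⊥-elim (¬p p)

    gauge-end : ∀ q w → q ▷ w ≡ ∗ → gauge q w ≡ 1#
    gauge-end q []      _ = refl
    gauge-end q (c ∷ w) p with length w ℕ.<? m | (q ▷ (c ∷ w)) ≟ ∗
    ... | yes _ | _ = refl
    ... | no _  | yes _ = refl
    ... | no _  | no ¬p = ⊥-elim (¬p p)

    gauge-long : ∀ q c w → length w ≡ m → q ▷ (c ∷ w) ≢ ∗ → gauge q (c ∷ w) ≡ l (q · c) w c ⁻¹
    gauge-long q c w e ¬p with length w ℕ.<? m | (q ▷ (c ∷ w)) ≟ ∗
    ... | yes p | _ = ⊥-elim (ℕ.<-irrefl e p)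
    ... | no _  | yes p = ⊥-elim (¬p p)
    ... | no _  | no _  = refl

    -- During a first return a context starts at `∗` only if it is all that has been read; it is
    -- then not merged with others and keeps its value. Otherwise an earlier letter `a` has been
    -- dropped, and `r` is the value that no longer depends on `a`.
    base : Step
    base q w b with q ≟ ∗
    ... | yes _ = μ q w b
    ... | no  _ = r q w b

    base-∗ : ∀ w b → base ∗ w b ≡ μ ∗ w b
    base-∗ w b with ∗ ≟ ∗
    ... | yes _ = refl
    ... | no ¬p = ⊥-elim (¬p refl)

    base-≢ : ∀ {q} w b → q ≢ ∗ → base q w b ≡ r q w b
    base-≢ {q} w b q≢ with q ≟ ∗
    ... | yes p = ⊥-elim (q≢ p)
    ... | no _  = refl

    lowered : Step
    lowered q w b = base q w b ∙ gauge q (w ∷ʳ b)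

    private
      regauge : ∀ {x g t t′ λ′} → g ≡ λ′ ⁻¹ → t ≈ λ′ ∙ t′ → (x ∙ g) ∙ t ≈ x ∙ t′
      regauge {x} {g} {t} {t′} {λ′} refl e = begin
        (x ∙ λ′ ⁻¹) ∙ t         ≈⟨ assoc _ _ _ ⟩
        x ∙ (λ′ ⁻¹ ∙ t)         ≈⟨ ∙-congˡ (∙-congˡ e) ⟩
        x ∙ (λ′ ⁻¹ ∙ (λ′ ∙ t′)) ≈⟨ ∙-congˡ (≈sym (assoc _ _ _)) ⟩
        x ∙ ((λ′ ⁻¹ ∙ λ′) ∙ t′) ≈⟨ ∙-congˡ (∙-congʳ (inverseˡ _)) ⟩
        x ∙ (1# ∙ t′)           ≈⟨ ∙-congˡ (identityˡ _) ⟩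
        x ∙ t′                  ∎

      ungauged : ∀ {x g t} → g ≡ 1# → (x ∙ g) ∙ t ≈ x ∙ t
      ungauged refl = ∙-congʳ (identityʳ _)

      ▷-∷ʳ : ∀ q w b → q ▷ (w ∷ʳ b) ≡ (q ▷ w) · b
      ▷-∷ʳ q w b = ▷-++ q w [ b ]

    -- The changes of gauge telescope: each `gauge` cancels the factor `l` produced by the rest of
    -- the reading, so that only the first `l` is left. The last step, returning to `∗`, carries no
    -- gauge.
    run-long : ∀ q a w y → length w ≡ m → (a ∷ w) ++ y ∈ S → Avoids (q · a) w → FirstReturn (q · a ▷ w) y →
               run m lowered (q · a , w) y ≈ l (q · a) w a ∙ run (suc m) μ (q , a ∷ w) y
    run-long q a w (b ∷ []) |w| p av (done e) = begin
      (base (q · a) w b ∙ gauge (q · a) (w ∷ʳ b)) ∙ 1#  ≈⟨ ungauged (gauge-end (q · a) (w ∷ʳ b) (trans (▷-∷ʳ (q · a) w b) e)) ⟩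
      base (q · a) w b ∙ 1#                             ≈⟨ ∙-congʳ (reflexive (base-≢ w b (avoids-head w av))) ⟩
      r (q · a) w b ∙ 1#                                ≈⟨ ∙-congʳ (l-r q a w b p) ⟨
      (l (q · a) w a ∙ μ q (a ∷ w) b) ∙ 1#              ≈⟨ assoc _ _ _ ⟩
      l (q · a) w a ∙ (μ q (a ∷ w) b ∙ 1#)              ∎
    run-long q a w (b ∷ y) |w| p av (step e fr) = begin
      (base (q · a) w b ∙ gauge (q · a) (w ∷ʳ b)) ∙ run m lowered (slide m (q · a) (w ∷ʳ b)) y
        ≈⟨ next (w ∷ʳ b) refl (trans (length-∷ʳ w b) (cong suc |w|)) ⟩
      base (q · a) w b ∙ run (suc m) μ (slide (suc m) q (a ∷ w ∷ʳ b)) y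
        ≈⟨ ∙-congʳ (reflexive (base-≢ w b (avoids-head w av))) ⟩
      r (q · a) w b ∙ _
        ≈⟨ ∙-congʳ (l-r q a w b (prefix∈ (a ∷ w ∷ʳ b) y p′)) ⟨
      (l (q · a) w a ∙ μ q (a ∷ w) b) ∙ _
        ≈⟨ assoc _ _ _ ⟩
      l (q · a) w a ∙ (μ q (a ∷ w) b ∙ run (suc m) μ (slide (suc m) q (a ∷ w ∷ʳ b)) y) ∎
      where
      p′ : (a ∷ w ∷ʳ b) ++ y ∈ S
      p′ = subst (λ z → a ∷ z ∈ S) (sym (++-assoc w [ b ] y)) p
      end : q · a ▷ (w ∷ʳ b) ≡ (q · a ▷ w) · b
      end = ▷-∷ʳ (q · a) w b
      -- The prolonged context is generalised to `v` so that its first letter, the one to be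
      -- dropped, can be matched.
      next : ∀ v → v ≡ w ∷ʳ b → length v ≡ suc m →
             (base (q · a) w b ∙ gauge (q · a) v) ∙ run m lowered (slide m (q · a) v) y ≈
             base (q · a) w b ∙ run (suc m) μ (slide (suc m) q (a ∷ v)) y
      next (c ∷ v) eq |cv| rewrite slide-long (q · a) c v (ℕ.suc-injective |cv|) | slide-long q a (c ∷ v) |cv| =
        regauge (gauge-long (q · a) c v (ℕ.suc-injective |cv|) (e ∘ trans (sym end) ∘ trans (cong (q · a ▷_) (sym eq))))
          (run-long (q · a) c v y (ℕ.suc-injective |cv|) (suffix∈ [ a ] _ (subst (λ z → (a ∷ z) ++ y ∈ S) (sym eq) p′))
            (subst (Avoids⁺ (q · a)) (sym eq) (avoids⁺-∷ʳ w (avoids⁺ w av) e))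
            (subst (λ z → FirstReturn z y) (trans (sym end) (cong (q · a ▷_) (sym eq))) fr))

    -- Both levels have the same context until `m` letters are read. When the next letter forces the
    -- first truncation, its `gauge` cancels the factor `l` of `run-long`.
    run-short : ∀ w y → length w ≤ m → w ++ y ∈ S → Avoids⁺ ∗ w → FirstReturn (∗ ▷ w) y →
                run m lowered (∗ , w) y ≈ run (suc m) μ (∗ , w) y
    run-short w (b ∷ []) |w| p av (done e) = begin
      (base ∗ w b ∙ gauge ∗ (w ∷ʳ b)) ∙ 1#  ≈⟨ ungauged (gauge-end ∗ (w ∷ʳ b) (trans (▷-∷ʳ ∗ w b) e)) ⟩
      base ∗ w b ∙ 1#                       ≈⟨ ∙-congʳ (reflexive (base-∗ w b)) ⟩
      μ ∗ w b ∙ 1#                          ∎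
    run-short w (b ∷ y) |w| p av (step e fr) = begin
      (base ∗ w b ∙ gauge ∗ (w ∷ʳ b)) ∙ run m lowered (slide m ∗ (w ∷ʳ b)) y
        ≈⟨ next (length w ℕ.<? m) ⟩
      base ∗ w b ∙ run (suc m) μ (∗ , w ∷ʳ b) y
        ≈⟨ ∙-cong (reflexive (base-∗ w b)) (reflexive (cong (λ z → run (suc m) μ z y) (sym (slide-short ∗ (w ∷ʳ b) |wb|)))) ⟩
      μ ∗ w b ∙ run (suc m) μ (slide (suc m) ∗ (w ∷ʳ b)) y ∎
      where
      |wb| : length (w ∷ʳ b) ≤ suc m
      |wb| = subst (_≤ suc m) (sym (length-∷ʳ w b)) (s≤s |w|)
      p′ : (w ∷ʳ b) ++ y ∈ S
      p′ = subst (_∈ S) (sym (++-assoc w [ b ] y)) p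
      end : ∗ ▷ (w ∷ʳ b) ≡ (∗ ▷ w) · b
      end = ▷-∷ʳ ∗ w b
      av′ : Avoids⁺ ∗ (w ∷ʳ b)
      av′ = avoids⁺-∷ʳ w av e
      fr′ : FirstReturn (∗ ▷ (w ∷ʳ b)) y
      fr′ = subst (λ z → FirstReturn z y) (sym end) fr
      next : Dec (length w < m) →
             (base ∗ w b ∙ gauge ∗ (w ∷ʳ b)) ∙ run m lowered (slide m ∗ (w ∷ʳ b)) y ≈
             base ∗ w b ∙ run (suc m) μ (∗ , w ∷ʳ b) y
      next (yes lt) = ≈trans (ungauged (gauge-short ∗ (w ∷ʳ b) le))
        (∙-congˡ (≈trans (reflexive (cong (λ z → run m lowered z y) (slide-short ∗ (w ∷ʳ b) le)))
                         (run-short (w ∷ʳ b) y le p′ av′ fr′)))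
        where
        le : length (w ∷ʳ b) ≤ m
        le = subst (_≤ m) (sym (length-∷ʳ w b)) lt
      next (no ¬lt) = helper (w ∷ʳ b) refl (trans (length-∷ʳ w b) (cong suc (ℕ.≤-antisym |w| (ℕ.≮⇒≥ ¬lt))))
        where
        helper : ∀ v → v ≡ w ∷ʳ b → length v ≡ suc m →
          (base ∗ w b ∙ gauge ∗ v) ∙ run m lowered (slide m ∗ v) y ≈ base ∗ w b ∙ run (suc m) μ (∗ , v) y
        helper (c ∷ v) eq |cv| rewrite slide-long ∗ c v (ℕ.suc-injective |cv|) =
          regauge (gauge-long ∗ c v (ℕ.suc-injective |cv|) (e ∘ trans (sym end) ∘ trans (cong (∗ ▷_) (sym eq))))
            (run-long ∗ c v y (ℕ.suc-injective |cv|) (subst (λ z → z ++ y ∈ S) (sym eq) p′) (subst (Avoids⁺ ∗) (sym eq) av′)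
              (subst (λ z → FirstReturn (∗ ▷ z) y) (sym eq) fr′))

  module _ (N : ℕ) (f : Word n → Carrier) where

    Realizes : ℕ → Step → Set _
    Realizes m μ = ∀ {x} → x ∈ S → length x ≤ N → FirstReturn ∗ x → run m μ (∗ , []) x ≈ f x

    lower : ∀ m → ∃ (Realizes m) → ∃ (Realizes 0)
    lower zero    p       = p
    lower (suc m) (μ , p) = lower m (Lower.lowered m μ , λ x∈ l fr →
      ≈trans (Lower.run-short m μ [] _ z≤n x∈ tt fr) (p x∈ l fr))

    -- At level `N` a word of length at most `N` is never truncated, so the context is the whole
    -- past and the returning step can carry the entire value `f`.
    top : Step
    top q w b with (q ▷ (w ∷ʳ b)) ≟ ∗
    ... | yes _ = f (w ∷ʳ b)
    ... | no _  = 1#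

    top-return : ∀ q w b → q ▷ (w ∷ʳ b) ≡ ∗ → top q w b ≡ f (w ∷ʳ b)
    top-return q w b e with (q ▷ (w ∷ʳ b)) ≟ ∗
    ... | yes _ = refl
    ... | no ¬e = ⊥-elim (¬e e)

    top-avoid : ∀ q w b → q ▷ (w ∷ʳ b) ≢ ∗ → top q w b ≡ 1#
    top-avoid q w b ¬e with (q ▷ (w ∷ʳ b)) ≟ ∗
    ... | yes e = ⊥-elim (¬e e)
    ... | no _  = refl

    run-top : ∀ w y → length (w ++ y) ≤ N → FirstReturn (∗ ▷ w) y → run N top (∗ , w) y ≈ f (w ++ y)
    run-top w (b ∷ []) l (done e) =
      ≈trans (identityʳ _) (reflexive (top-return ∗ w b (trans (▷-++ ∗ w [ b ]) e)))
    run-top w (b ∷ y) l (step e fr) = begin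
      top ∗ w b ∙ run N top (slide N ∗ (w ∷ʳ b)) y
        ≈⟨ ∙-cong (reflexive (top-avoid ∗ w b (e ∘ trans (sym (▷-++ ∗ w [ b ])))))
                  (reflexive (cong (λ z → run N top z y) (slide-short ∗ (w ∷ʳ b) |wb|))) ⟩
      1# ∙ run N top (∗ , w ∷ʳ b) y ≈⟨ identityˡ _ ⟩
      run N top (∗ , w ∷ʳ b) y      ≈⟨ run-top (w ∷ʳ b) y l′ (subst (λ z → FirstReturn z y) (sym (▷-++ ∗ w [ b ])) fr) ⟩
      f ((w ∷ʳ b) ++ y)             ≈⟨ reflexive (cong f (++-assoc w [ b ] y)) ⟩
      f (w ++ b ∷ y)                ∎
      where
      l′ : length ((w ∷ʳ b) ++ y) ≤ N
      l′ = subst (_≤ N) (cong length (sym (++-assoc w [ b ] y))) l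
      |wb| : length (w ∷ʳ b) ≤ N
      |wb| = ℕ.≤-trans (subst (length (w ∷ʳ b) ≤_) (sym (length-++ (w ∷ʳ b))) (ℕ.m≤m+n _ _)) l′

    extension : ∃ λ (ν : Q → Fin n → Carrier) →
                ∀ {x} → x ∈ S → length x ≤ N → FirstReturn ∗ x → productAlong ν ∗ x ≈ f x
    extension with lower N (top , λ _ → run-top [] _)
    -- At level 0 contexts are empty, and a step depends on the state and the letter only.
    ... | μ , p = (λ q b → μ q [] b) , λ {x} x∈ l fr → ≈trans (reflexive (sym (run-0 ∗ x))) (p x∈ l fr)
      where
      run-0 : ∀ q x → run 0 μ (q , []) x ≡ productAlong (λ q b → μ q [] b) q x
      run-0 q []      = refl
      run-0 q (b ∷ x) = cong (μ q [] b ∙_) (run-0 (q · b) x)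

-- Right cosets of a subgroup, and their numbering in finite index.

module RightCosets (G : Group c ℓ) {H : Pred (Group.Carrier G) h} (subgroup : IsSubgroup G H) where
  open Group G renaming (refl to ≈refl; sym to ≈sym; trans to ≈trans)
  open IsSubgroup subgroup
  open import Algebra.Properties.Group G
  open import Relation.Binary.Reasoning.Setoid setoid

  infix 4 _~_
  _~_ : Carrier → Carrier → Set h
  g ~ k = (g ∙ k ⁻¹) ∈ H

  ~-reflexive : ∀ {g k} → g ≈ k → g ~ k
  ~-reflexive {g} {k} e = resp (≈sym (≈trans (∙-congʳ e) (inverseʳ k))) ε-closed

  ~-sym : ∀ {g k} → g ~ k → k ~ g
  ~-sym {g} {k} p = resp (begin
    (g ∙ k ⁻¹) ⁻¹      ≈⟨ ⁻¹-anti-homo-∙ g (k ⁻¹) ⟩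
    (k ⁻¹) ⁻¹ ∙ g ⁻¹   ≈⟨ ∙-congʳ (⁻¹-involutive k) ⟩
    k ∙ g ⁻¹           ∎) (⁻¹-closed p)

  ~-trans : ∀ {g k l} → g ~ k → k ~ l → g ~ l
  ~-trans {g} {k} {l} p q = resp (begin
    (g ∙ k ⁻¹) ∙ (k ∙ l ⁻¹)  ≈⟨ assoc _ _ _ ⟩
    g ∙ (k ⁻¹ ∙ (k ∙ l ⁻¹))  ≈⟨ ∙-congˡ (≈sym (assoc _ _ _)) ⟩
    g ∙ ((k ⁻¹ ∙ k) ∙ l ⁻¹)  ≈⟨ ∙-congˡ (∙-congʳ (inverseˡ k)) ⟩
    g ∙ (ε ∙ l ⁻¹)           ≈⟨ ∙-congˡ (identityˡ _) ⟩
    g ∙ l ⁻¹                 ∎) (∙-closed p q)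

  ~-∙ : ∀ {g k} x → g ~ k → (g ∙ x) ~ (k ∙ x)
  ~-∙ {g} {k} x p = resp (≈sym (begin
    (g ∙ x) ∙ (k ∙ x) ⁻¹     ≈⟨ ∙-congˡ (⁻¹-anti-homo-∙ k x) ⟩
    (g ∙ x) ∙ (x ⁻¹ ∙ k ⁻¹)  ≈⟨ assoc _ _ _ ⟩
    g ∙ (x ∙ (x ⁻¹ ∙ k ⁻¹))  ≈⟨ ∙-congˡ (≈sym (assoc _ _ _)) ⟩
    g ∙ ((x ∙ x ⁻¹) ∙ k ⁻¹)  ≈⟨ ∙-congˡ (∙-congʳ (inverseʳ x)) ⟩
    g ∙ (ε ∙ k ⁻¹)           ≈⟨ ∙-congˡ (identityˡ _) ⟩
    g ∙ k ⁻¹                 ∎)) p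

  ~-cancel : ∀ {g k} x → (g ∙ x) ~ (k ∙ x) → g ~ k
  ~-cancel {g} {k} x p = ~-trans (~-reflexive (≈sym (undo g))) (~-trans (~-∙ (x ⁻¹) p) (~-reflexive (undo k)))
    where
    undo : ∀ y → (y ∙ x) ∙ x ⁻¹ ≈ y
    undo y = ≈trans (assoc _ _ _) (≈trans (∙-congˡ (inverseʳ x)) (identityʳ y))

  ∈⇒~ε : ∀ {g} → g ∈ H → g ~ ε
  ∈⇒~ε {g} = resp (≈sym (≈trans (∙-congˡ ε⁻¹≈ε) (identityʳ g)))

  ~ε⇒∈ : ∀ {g} → g ~ ε → g ∈ H
  ~ε⇒∈ {g} = resp (≈trans (∙-congˡ ε⁻¹≈ε) (identityʳ g))

  ∙~ : ∀ {g} k → g ∈ H → (g ∙ k) ~ k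
  ∙~ {g} k g∈ = ~-trans (~-∙ k (∈⇒~ε g∈)) (~-reflexive (identityˡ k))

  module Index {d} (index : HasIndex G H d) where
    open HasIndex index

    coset : Carrier → Fin d
    coset g = proj₁ (covering g)

    coset-rep : ∀ g → g ~ representative (coset g)
    coset-rep g = proj₂ (covering g)

    ~⇒coset : ∀ {g k} → g ~ k → coset g ≡ coset k
    ~⇒coset p = distinct (~-trans (~-sym (coset-rep _)) (~-trans p (coset-rep _)))

    coset⇒~ : ∀ {g k} → coset g ≡ coset k → g ~ k
    coset⇒~ {g} {k} e = ~-trans (subst (λ i → g ~ representative i) e (coset-rep g)) (~-sym (coset-rep k))

    coset-representative : ∀ i → coset (representative i) ≡ i
    coset-representative i = sym (distinct (coset-rep (representative i)))

-- Permutations of stacks without adjacent inverses.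

module Stacks {D : Set a} (_≟_ : DecidableEquality D) (ι : D → D) (ι-inv : Involutive _≡_ ι) where

  NoInverses : List D → Set a
  NoInverses = Linked (λ y z → z ≢ ι y)

  -- Left multiplication by the generator `x` on reduced sequences, with `ι` as inversion: van der
  -- Waerden's action on normal forms.
  push : D → List D → List D
  push x []      = [ x ]
  push x (y ∷ l) with y ≟ ι x
  ... | yes _ = l
  ... | no  _ = x ∷ y ∷ l

  push-≢ : ∀ {x y} l → y ≢ ι x → push x (y ∷ l) ≡ x ∷ y ∷ l
  push-≢ {x} {y} l y≢ with y ≟ ι x
  ... | yes y≡ = ⊥-elim (y≢ y≡)
  ... | no _   = refl

  push-noInverses : ∀ x {l} → NoInverses l → NoInverses (push x l)
  push-noInverses x {[]}    _ = [-]
  push-noInverses x {y ∷ l} p with y ≟ ι x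
  ... | yes _  = Linked.tail p
  ... | no y≢ = y≢ ∷ p

  push-cancel : ∀ x y {l} → y ≡ ι x → NoInverses l → push y (push x l) ≡ l
  push-cancel x y {[]} refl _ with x ≟ ι (ι x)
  ... | yes _ = refl
  ... | no ¬p = ⊥-elim (¬p (sym (ι-inv x)))
  push-cancel x y {z ∷ l} y≡ p with z ≟ ι x
  push-cancel x y {z ∷ l} refl p | no z≢ with x ≟ ι (ι x)
  ... | yes _ = refl
  ... | no ¬p = ⊥-elim (¬p (sym (ι-inv x)))
  push-cancel x y {z ∷ []}     refl p        | yes refl = refl
  push-cancel x y {z ∷ t ∷ l} refl (t≢ ∷ p) | yes refl = push-≢ l t≢

  -- The laws are restricted to stacks without inverses, because on other stacks `push (ι x)` need
  -- not undo `push x`.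
  record Permutation : Set a where
    field
      to from         : List D → List D
      to-noInverses   : ∀ {l} → NoInverses l → NoInverses (to l)
      from-noInverses : ∀ {l} → NoInverses l → NoInverses (from l)
      to-from         : ∀ {l} → NoInverses l → to (from l) ≡ l
      from-to         : ∀ {l} → NoInverses l → from (to l) ≡ l
  open Permutation

  permutations : Group a a
  permutations = record
    { Carrier = Permutation
    ; _≈_ = λ p q → ∀ {l} → NoInverses l → to p l ≡ to q l
    ; _∙_ = λ p q → record
      { to = to p ∘ to q ; from = from q ∘ from p
      ; to-noInverses = to-noInverses p ∘ to-noInverses q
      ; from-noInverses = from-noInverses q ∘ from-noInverses p
      ; to-from = λ r → trans (cong (to p) (to-from q (from-noInverses p r))) (to-from p r)
      ; from-to = λ r → trans (cong (from q) (from-to p (to-noInverses q r))) (from-to q r) }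
    ; ε = record
      { to = λ l → l ; from = λ l → l ; to-noInverses = λ r → r ; from-noInverses = λ r → r
      ; to-from = λ _ → refl ; from-to = λ _ → refl }
    ; _⁻¹ = λ p → record
      { to = from p ; from = to p
      ; to-noInverses = from-noInverses p ; from-noInverses = to-noInverses p
      ; to-from = from-to p ; from-to = to-from p }
    ; isGroup = record
      { isMonoid = record
        { isSemigroup = record
          { isMagma = record
            { isEquivalence = record
              { refl = λ _ → refl ; sym = λ e r → sym (e r) ; trans = λ e f r → trans (e r) (f r) }
            ; ∙-cong = λ {p} {p′} {q} {q′} e f r → trans (cong (to p) (f r)) (e (to-noInverses q′ r)) }
          ; assoc = λ _ _ _ _ → refl }
        ; identity = (λ _ _ → refl) , (λ _ _ → refl) }
      ; inverse = (λ p → from-to p) , (λ p → to-from p)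
      ; ⁻¹-cong = λ {p} {q} e {l} r →
          trans (cong (from p) (sym (trans (e (from-noInverses q r)) (to-from q r))))
                (from-to p (from-noInverses q r)) } }

  pushing : D → Permutation
  pushing x = record
    { to = push x ; from = push (ι x)
    ; to-noInverses = push-noInverses x ; from-noInverses = push-noInverses (ι x)
    ; to-from = push-cancel (ι x) x (sym (ι-inv x))
    ; from-to = push-cancel x (ι x) refl }

ℤ₂ : Group 0ℓ 0ℓ
ℤ₂ = CommutativeRing.+-group xor-∧-commutativeRing

-- Inverse words, and the two trees of the empty word in a specular set.

module _ {n} (θ : Fin n → Fin n) where

  inverse-∷ : ∀ a w → inverse θ (a ∷ w) ≡ inverse θ w ∷ʳ θ a
  inverse-∷ a w = unfold-reverse (θ a) (map θ w)

  inverse-++ : ∀ u v → inverse θ (u ++ v) ≡ inverse θ v ++ inverse θ u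
  inverse-++ u v = trans (cong reverse (map-++ θ u v)) (reverse-++ (map θ u) (map θ v))

  length-inverse : ∀ w → length (inverse θ w) ≡ length w
  length-inverse w = trans (length-reverse (map θ w)) (length-map θ w)

  inverse-involutive : Involutive _≡_ θ → Involutive _≡_ (inverse θ)
  inverse-involutive θ-inv []      = refl
  inverse-involutive θ-inv (a ∷ w) = begin
    inverse θ (inverse θ (a ∷ w))         ≡⟨ cong (inverse θ) (inverse-∷ a w) ⟩
    inverse θ (inverse θ w ∷ʳ θ a)        ≡⟨ inverse-++ (inverse θ w) [ θ a ] ⟩
    θ (θ a) ∷ inverse θ (inverse θ w)     ≡⟨ cong₂ _∷_ (θ-inv a) (inverse-involutive θ-inv w) ⟩
    a ∷ w                                 ∎
    where open ≡-Reasoning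

module Specular {n} (θ : Fin n → Fin n) (θ-inv : Involutive _≡_ θ) (S : Pred (Word n) s) (specular : IsSpecular θ S) where
  open IsSpecular specular
  open IsLaminary laminary using (reduced; inverseClosed) public
  open TreeSet S treeSet public

  compL compR : Fin n → Fin 2
  compL a = component (inj₁ a)
  compR b = component (inj₂ b)

  -- Potentials in ℤ₂ for [a < θ b] change, when added to their image under the
  -- involution a ↔ θ a exchanging the two sides of ℰ [], by 1 along each edge;
  -- hence no vertex is connected to its image, on the other side.
  compL≢compR-θ : ∀ a → compL a ≢ compR (θ a)
  compL≢compR-θ a₀ same = contradiction (potential-θ a₀) (along (proj₂ (component-walk same)))
    where
    m : Fin n → Fin n → Bool
    m a b = does (a Fin.<? θ b)

    pots : Potentials ℤ₂ [] m
    pots = potentials ℤ₂ [] m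

    l r : Fin n → Bool
    l = proj₁ pots
    r = proj₁ (proj₂ pots)

    -- With `not` on the right side, `g` is constant along edges, while `a` on the left and `θ a` on
    -- the right get opposite values.
    g : V → Bool
    g (inj₁ a) = l a xor r (θ a)
    g (inj₂ b) = not (l (θ b) xor r b)

    m-θ : ∀ {a b} → a ∷ b ∷ [] ∈ S → m (θ b) (θ a) ≡ not (m a b)
    m-θ {a} {b} p rewrite θ-inv a with Fin.<-cmp a (θ b)
    ... | tri< lt _ ¬gt rewrite dec-true (a Fin.<? θ b) lt | dec-false (θ b Fin.<? a) ¬gt = refl
    ... | tri> ¬lt _ gt rewrite dec-false (a Fin.<? θ b) ¬lt | dec-true (θ b Fin.<? a) gt = refl
    -- Here `b` is `θ a`, so the word `a b` of `S` would not be reduced.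
    ... | tri≈ _ a≡ _ = ⊥-elim (reduced p [] a [] (cong (λ z → a ∷ z ∷ []) (trans (sym (θ-inv b)) (cong θ (sym a≡)))))

    bool : ∀ x y z → x xor (y xor not z) ≡ not (y xor (x xor z))
    bool false false false = refl
    bool false false true  = refl
    bool false true  false = refl
    bool false true  true  = refl
    bool true  false false = refl
    bool true  false true  = refl
    bool true  true  false = refl
    bool true  true  true  = refl

    g-edge : ∀ {a b} → a ∷ b ∷ [] ∈ S → g (inj₁ a) ≡ g (inj₂ b)
    g-edge {a} {b} p = begin
      l a xor r (θ a)                                ≡⟨ cong (l a xor_) (sym (proj₂ (proj₂ pots) (θ b) (θ a) (inverseClosed p))) ⟩
      l a xor (l (θ b) xor m (θ b) (θ a))            ≡⟨ cong (λ z → l a xor (l (θ b) xor z)) (m-θ p) ⟩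
      l a xor (l (θ b) xor not (m a b))              ≡⟨ bool (l a) (l (θ b)) (m a b) ⟩
      not (l (θ b) xor (l a xor m a b))              ≡⟨ cong (λ z → not (l (θ b) xor z)) (proj₂ (proj₂ pots) a b p) ⟩
      not (l (θ b) xor r b)                          ∎
      where open ≡-Reasoning

    along : ∀ {u v xs} → Walks.Walk (ℰ []) u xs v → g u ≡ g v
    along Walks.[] = refl
    along ((_ , _ , edge p) Walks.∷ w)  = trans (g-edge p) (along w)
    along ((_ , _ , edge⁻ p) Walks.∷ w) = trans (sym (g-edge p)) (along w)

    potential-θ : ∀ a → g (inj₂ (θ a)) ≡ not (g (inj₁ a))
    potential-θ a = cong (λ z → not (l z xor r (θ a))) (θ-inv a)

    contradiction : ∀ {x y} → y ≡ not x → x ≡ y → ⊥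
    contradiction {false} refl ()
    contradiction {true}  refl ()

  -- A letter `b` is an arrow from the tree `compR b` to the tree `compL b`, and words of `S` are
  -- paths of such arrows. From `i`, either `b` starts there and is followed, or `θ b` ends there
  -- and is followed against its direction.
  next : Fin 2 → Fin n → Fin 2
  next i b with compR b Fin.≟ i
  ... | yes _ = compL b
  ... | no  _ = compR (θ b)

  private
    other : ∀ {i j k : Fin 2} → i ≢ k → j ≢ k → i ≡ j
    other {zero}     {zero}     _ _ = refl
    other {suc zero} {suc zero} _ _ = refl
    other {zero}     {suc zero} {zero}     p _ = ⊥-elim (p refl)
    other {zero}     {suc zero} {suc zero} _ p = ⊥-elim (p refl)
    other {suc zero} {zero}     {suc zero} p _ = ⊥-elim (p refl)
    other {suc zero} {zero}     {zero}     _ p = ⊥-elim (p refl)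

  -- Both sides differ from `compR b`, and there are only two trees.
  compL-θ : ∀ {i b} → compR b ≢ i → compL (θ b) ≡ i
  compL-θ {i} {b} ne = other (subst (λ z → compL (θ b) ≢ compR z) (θ-inv b) (compL≢compR-θ (θ b))) (ne ∘ sym)

  next-compR : ∀ {i b} → compR b ≡ i → next i b ≡ compL b
  next-compR {i} {b} e with compR b Fin.≟ i
  ... | yes _ = refl
  ... | no ¬e = ⊥-elim (¬e e)

  next-≢compR : ∀ {i b} → compR b ≢ i → next i b ≡ compR (θ b)
  next-≢compR {i} {b} ¬e with compR b Fin.≟ i
  ... | yes e = ⊥-elim (¬e e)
  ... | no _  = refl

  next-θ : ∀ i b → next (next i b) (θ b) ≡ i
  next-θ i b with compR b Fin.≟ i
  ... | yes e = trans (next-≢compR (compL≢compR-θ b ∘ sym)) (trans (cong compR (θ-inv b)) e)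
  ... | no ¬e = trans (next-compR refl) (compL-θ ¬e)

-- Prime words as first returns in the coset action; cocycles; freeness.

module FiniteIndex {n} (θ : Fin n → Fin n) (θ-inv : Involutive _≡_ θ)
  (S : Pred (Word n) s) (specular : IsSpecular θ S)
  (H : Pred (Word n) h) (subgroup : IsSubgroup (groupOf θ θ-inv) H) {d} (index : HasIndex (groupOf θ θ-inv) H d) where

  open Specular θ θ-inv S specular public

  G : Group 0ℓ 0ℓ
  G = groupOf θ θ-inv
  module G = Group G

  open IsSubgroup subgroup
  open HasIndex index using (representative)
  module Hᶜ = RightCosets G subgroup
  open Hᶜ
  open Index index public

  _·_ : Fin d → Fin n → Fin d
  q · a = coset (representative q ++ [ a ])

  ∗ : Fin d
  ∗ = coset []

  open PointedAction _·_ ∗ public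

  coset-· : ∀ g a → coset g · a ≡ coset (g ++ [ a ])
  coset-· g a = ~⇒coset {representative (coset g) ++ [ a ]} {g ++ [ a ]}
    (~-∙ {representative (coset g)} {g} [ a ] (~-sym {g} {representative (coset g)} (coset-rep g)))

  ·-θ : ∀ q a → (q · a) · θ a ≡ q
  ·-θ q a = begin
    (q · a) · θ a                              ≡⟨ coset-· (representative q ++ [ a ]) (θ a) ⟩
    coset ((representative q ++ [ a ]) ++ [ θ a ]) ≡⟨ ~⇒coset (~-reflexive
      (G.trans (G.assoc (representative q) [ a ] [ θ a ]) (G.trans (G.∙-congˡ {representative q} (relator a)) (G.identityʳ _)))) ⟩
    coset (representative q)                   ≡⟨ coset-representative q ⟩
    q                                          ∎
    where open ≡-Reasoning

  coset-▷ : ∀ g w → coset g ▷ w ≡ coset (g ++ w)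
  coset-▷ g []      = cong coset (sym (++-identityʳ g))
  coset-▷ g (a ∷ w) = begin
    coset g · a ▷ w           ≡⟨ cong (_▷ w) (coset-· g a) ⟩
    coset (g ++ [ a ]) ▷ w    ≡⟨ coset-▷ (g ++ [ a ]) w ⟩
    coset ((g ++ [ a ]) ++ w) ≡⟨ cong coset (++-assoc g [ a ] w) ⟩
    coset (g ++ a ∷ w)        ∎
    where open ≡-Reasoning

  ∈H⇒▷ : ∀ {w} → w ∈ H → ∗ ▷ w ≡ ∗
  ∈H⇒▷ {w} w∈ = trans (coset-▷ [] w) (~⇒coset (∈⇒~ε w∈))

  ▷⇒∈H : ∀ {w} → ∗ ▷ w ≡ ∗ → w ∈ H
  ▷⇒∈H {w} e = ~ε⇒∈ (coset⇒~ (trans (sym (coset-▷ [] w)) e))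

  ▷-inverse : ∀ q w → q ▷ w ▷ inverse θ w ≡ q
  ▷-inverse q w = trans (sym (▷-++ q w (inverse θ w))) (▷-resp θ ·-θ (G.inverseʳ w) q)

  Prime : Pred (Word n) (s ⊔ h)
  Prime = IsPrimeWord S H

  prime∈S : ∀ {x} → x ∈ Prime → x ∈ S
  prime∈S p = proj₂ (IsPrimeWord.member p)

  prime∈H : ∀ {x} → x ∈ Prime → x ∈ H
  prime∈H p = proj₁ (IsPrimeWord.member p)

  prime⇒firstReturn : ∀ {x} → x ∈ Prime → FirstReturn ∗ x
  prime⇒firstReturn {x} p = mkFirstReturn x nonempty (∈H⇒▷ (prime∈H p))
    λ { u v refl u≢ v≢ e → prime u v refl u≢ v≢ (▷⇒∈H e , prefix∈ u v (prime∈S p)) }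
    where open IsPrimeWord p

  firstReturn⇒prime : ∀ {x} → x ∈ S → FirstReturn ∗ x → x ∈ Prime
  firstReturn⇒prime x∈ fr = record
    { nonempty = firstReturn-≢[] fr
    ; member = ▷⇒∈H (firstReturn-returns fr) , x∈
    ; prime = λ u v eq u≢ v≢ (u∈ , _) → firstReturn-first fr u v eq u≢ v≢ (∈H⇒▷ u∈) }

  inverse-≢[] : ∀ {w} → w ≢ [] → inverse θ w ≢ []
  inverse-≢[] {w} w≢ e = w≢ (trans (sym (inverse-involutive θ θ-inv w)) (cong (inverse θ) e))

  -- If the inverse of `x` is `u v` with `u` in `H`, then the prefix `inverse θ v` of `x` equals
  -- `x u` in the group, so it lies in `H` and contradicts the primality of `x`.
  prime-inverse : ∀ {x} → x ∈ Prime → inverse θ x ∈ Prime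
  prime-inverse {x} p = record
    { nonempty = inverse-≢[] nonempty
    ; member = ⁻¹-closed (prime∈H p) , inverseClosed (prime∈S p)
    ; prime = λ u v eq u≢ v≢ (u∈H , u∈S) →
        let x≡ : x ≡ inverse θ v ++ inverse θ u
            x≡ = trans (sym (inverse-involutive θ θ-inv x)) (trans (cong (inverse θ) eq) (inverse-++ θ u v))
        in prime (inverse θ v) (inverse θ u) x≡ (inverse-≢[] v≢) (inverse-≢[] u≢)
           ( resp (∙-cancelʳ x≡) (∙-closed (prime∈H p) u∈H)
           , prefix∈ (inverse θ v) (inverse θ u) (subst (_∈ S) x≡ (prime∈S p)) ) }
    where
    open IsPrimeWord p
    ∙-cancelʳ : ∀ {u v} → x ≡ v ++ inverse θ u → x ++ u G.≈ v
    ∙-cancelʳ {u} {v} refl = G.trans (G.assoc v (inverse θ u) u) (G.trans (G.∙-congˡ {v} (G.inverseˡ u)) (G.identityʳ v))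

  -- A letter b is read forwards from a state (q , i) if it leaves the i-th
  -- tree of ℰ [], and otherwise as the inverse of θ b read backwards.
  _·′_ : Fin d × Fin 2 → Fin n → Fin d × Fin 2
  (q , i) ·′ b = q · b , next i b

  module Oriented = Action _·′_

  ·′-θ : ∀ q a → (q ·′ a) ·′ θ a ≡ q
  ·′-θ (q , i) a = ×-≡,≡→≡ (·-θ q a , next-θ i a)

  oriented-▷ : ∀ q i w → proj₁ ((q , i) Oriented.▷ w) ≡ q ▷ w
  oriented-▷ q i []      = refl
  oriented-▷ q i (a ∷ w) = oriented-▷ (q · a) (next i a) w

  module Cocycles (Γ : Group c ℓ′) (N : ℕ) (f : Word n → Group.Carrier Γ) where
    open Group Γ renaming (ε to 1#; sym to ≈sym; trans to ≈trans; refl to ≈refl) hiding (inverse)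
    open import Algebra.Properties.Group Γ
    open import Relation.Binary.Reasoning.Setoid setoid
    open Values Γ

    primeExtension : ∃ λ (ν : Fin d → Fin n → Carrier) → ∀ {x} → x ∈ Prime → length x ≤ N → productAlong ν ∗ x ≈ f x
    primeExtension = proj₁ ext , λ x∈ l → proj₂ ext (prime∈S x∈) l (prime⇒firstReturn x∈)
      where ext = Extension.extension S (IsSpecular.treeSet specular) Fin._≟_ _·_ ∗ θ ·-θ Γ N f

    open Oriented.Values Γ using () renaming (productAlong to productAlong′)

    module _ (ν : Fin d → Fin n → Carrier) where

      φ : Fin d × Fin 2 → Fin n → Carrier
      φ (q , i) b with compR b Fin.≟ i
      ... | yes _ = ν q b
      ... | no  _ = ν (q · b) (θ b) ⁻¹

      φ-forwards : ∀ {q i b} → compR b ≡ i → φ (q , i) b ≡ ν q b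
      φ-forwards {i = i} {b} e with compR b Fin.≟ i
      ... | yes _ = refl
      ... | no ¬e = ⊥-elim (¬e e)

      φ-backwards : ∀ {q i b} → compR b ≢ i → φ (q , i) b ≡ ν (q · b) (θ b) ⁻¹
      φ-backwards {i = i} {b} ¬e with compR b Fin.≟ i
      ... | yes e = ⊥-elim (¬e e)
      ... | no _ = refl

      φ-θ : ∀ q a → φ q a ∙ φ (q ·′ a) (θ a) ≈ 1#
      φ-θ (q , i) a with compR a Fin.≟ i
      ... | yes e = begin
        ν q a ∙ φ (q · a , compL a) (θ a)            ≡⟨ cong (ν q a ∙_) (φ-backwards (compL≢compR-θ a ∘ sym)) ⟩
        ν q a ∙ ν ((q · a) · θ a) (θ (θ a)) ⁻¹       ≡⟨ cong₂ (λ x y → ν q a ∙ ν x y ⁻¹) (·-θ q a) (θ-inv a) ⟩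
        ν q a ∙ ν q a ⁻¹                             ≈⟨ inverseʳ _ ⟩
        1# ∎
      ... | no ¬e = ≈trans (∙-congˡ (reflexive (φ-forwards refl))) (inverseˡ _)

      -- Consecutive letters of a word of `S` are joined by an edge of `ℰ []`, so each next letter
      -- starts in the tree just reached and is again read forwards.
      forwards : ∀ q i b w → b ∷ w ∈ S → compR b ≡ i → productAlong′ φ (q , i) (b ∷ w) ≈ productAlong ν q (b ∷ w)
      forwards q i b []      _ e = ∙-congʳ (reflexive (φ-forwards e))
      forwards q i b (b′ ∷ w) p e = ∙-cong (reflexive (φ-forwards e))
        (forwards (q · b) (next i b) b′ w (suffix∈ [ b ] _ p)
          (trans (sym (component-edge (prefix∈ (b ∷ b′ ∷ []) w p))) (sym (next-compR e))))

      -- After `b` is read backwards the current tree is `compR (θ b)`, not `compL b`, where the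
      -- next letter starts; so that letter is read backwards as well. The factors are those of the
      -- inverse word, inverted and in opposite order.
      backwards : ∀ q i b w → b ∷ w ∈ S → compR b ≢ i →
                  productAlong′ φ (q , i) (b ∷ w) ≈ productAlong ν (q ▷ (b ∷ w)) (inverse θ (b ∷ w)) ⁻¹
      backwards q i b w p ¬e = begin
        φ (q , i) b ∙ productAlong′ φ (q · b , next i b) w
          ≈⟨ ∙-cong (reflexive (φ-backwards ¬e)) (rest w p) ⟩
        ν (q · b) (θ b) ⁻¹ ∙ P ⁻¹
          ≈⟨ ⁻¹-anti-homo-∙ P (ν (q · b) (θ b)) ⟨
        (P ∙ ν (q · b) (θ b)) ⁻¹
          ≈⟨ ⁻¹-cong (∙-congˡ (≈trans (reflexive (cong (λ z → ν z (θ b)) (sym (▷-inverse (q · b) w)))) (≈sym (identityʳ _)))) ⟩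
        (P ∙ productAlong ν (q · b ▷ w ▷ inverse θ w) [ θ b ]) ⁻¹
          ≈⟨ ⁻¹-cong (productAlong-++ ν _ (inverse θ w) [ θ b ]) ⟨
        productAlong ν (q · b ▷ w) (inverse θ w ∷ʳ θ b) ⁻¹
          ≡⟨ cong (λ z → productAlong ν (q · b ▷ w) z ⁻¹) (inverse-∷ θ b w) ⟨
        productAlong ν (q · b ▷ w) (inverse θ (b ∷ w)) ⁻¹ ∎
        where
        P : Carrier
        P = productAlong ν (q · b ▷ w) (inverse θ w)
        rest : ∀ w → b ∷ w ∈ S → productAlong′ φ (q · b , next i b) w ≈ productAlong ν (q · b ▷ w) (inverse θ w) ⁻¹
        rest []       _ = ≈sym ε⁻¹≈ε
        rest (b′ ∷ w) p = backwards (q · b) (next i b) b′ w (suffix∈ [ b ] _ p) λ e →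
          compL≢compR-θ b (trans (component-edge (prefix∈ (b ∷ b′ ∷ []) w p)) (trans e (next-≢compR ¬e)))

    -- Read forwards, a prime word has the value given by the extension; read backwards, it has the
    -- inverse of the value of its inverse, which is the same by hypothesis. Hence the starting tree
    -- `i` does not matter, although it changes from one prime factor to the next.
    cocycle : (∀ x → f (inverse θ x) ≈ f x ⁻¹) →
      ∃ λ (φ : Fin d × Fin 2 → Fin n → Carrier) → (∀ q a → φ q a ∙ φ (q ·′ a) (θ a) ≈ 1#) ×
        (∀ i {x} → x ∈ Prime → length x ≤ N → productAlong′ φ (∗ , i) x ≈ f x)
    cocycle f-inverse = φ ν , φ-θ ν , value
      where
      ν = proj₁ primeExtension
      ν-f = proj₂ primeExtension
      value : ∀ i {x} → x ∈ Prime → length x ≤ N → productAlong′ (φ ν) (∗ , i) x ≈ f x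
      value i {[]}    p l = ⊥-elim (IsPrimeWord.nonempty p refl)
      value i {b ∷ w} p l = direction (compR b Fin.≟ i)
        where
        direction : Dec (compR b ≡ i) → productAlong′ (φ ν) (∗ , i) (b ∷ w) ≈ f (b ∷ w)
        direction (yes e) = ≈trans (forwards ν ∗ i b w (prime∈S p) e) (ν-f p l)
        direction (no ¬e) = begin
          productAlong′ (φ ν) (∗ , i) (b ∷ w)                  ≈⟨ backwards ν ∗ i b w (prime∈S p) ¬e ⟩
          productAlong ν (∗ ▷ (b ∷ w)) (inverse θ (b ∷ w)) ⁻¹  ≡⟨ cong (λ z → productAlong ν z (inverse θ (b ∷ w)) ⁻¹) (∈H⇒▷ (prime∈H p)) ⟩
          productAlong ν ∗ (inverse θ (b ∷ w)) ⁻¹              ≈⟨ ⁻¹-cong (ν-f (prime-inverse p) (subst (_≤ N) (sym (length-inverse θ (b ∷ w))) l)) ⟩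
          f (inverse θ (b ∷ w)) ⁻¹                             ≈⟨ ⁻¹-cong (f-inverse (b ∷ w)) ⟩
          f (b ∷ w) ⁻¹ ⁻¹                                      ≈⟨ ⁻¹-involutive _ ⟩
          f (b ∷ w)                                            ∎

  _≟ʷ_ : DecidableEquality (Word n)
  _≟ʷ_ = ≡-dec Fin._≟_

  length-factors : ∀ ys → All (λ y → length y ≤ length (product G ys)) ys
  length-factors []       = []
  length-factors (y ∷ ys) = subst (length y ≤_) (sym (length-++ y)) (ℕ.m≤m+n _ _)
    ∷ All.map (λ l → ℕ.≤-trans l (subst (length (product G ys) ≤_) (sym (length-++ y)) (ℕ.m≤n+m _ _))) (length-factors ys)

  open Stacks _≟ʷ_ (inverse θ) (inverse-involutive θ θ-inv) public

  -- With a cocycle sending every factor `y` to `push y`, the product acts on the empty stack by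
  -- piling up `ys`, as no two neighbours cancel. A product equal to 1 leaves that stack empty.
  primes-free : ∀ {ys} → All Prime ys → NoInverses ys → product G ys G.≈ [] → ys ≡ []
  primes-free {ys} ps ns e =
    trans (sym (evaluate zero ys ps (length-factors ys) ns)) (Oriented.productAlong-resp θ ·′-θ permutations φ φ-θ e (∗ , zero) [])
    where
    -- The length of the whole product bounds that of every factor; the condition on inverses holds
    -- by the definition of `pushing`.
    C = Cocycles.cocycle permutations (length (product G ys)) pushing (λ x _ → refl)
    φ = proj₁ C
    φ-θ = proj₁ (proj₂ C)
    φ-value = proj₂ (proj₂ C)
    open Permutation
    open Oriented.Values permutations using (productAlong; productAlong-++)
    evaluate : ∀ i zs → All Prime zs → All (λ z → length z ≤ length (product G ys)) zs → NoInverses zs →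
               to (productAlong φ (∗ , i) (product G zs)) [] ≡ zs
    evaluate i []       _        _        _  = refl
    evaluate i (z ∷ zs) (p ∷ ps) (l ∷ ls) ns = begin
      to (productAlong φ (∗ , i) (z ++ product G zs)) []
        ≡⟨ productAlong-++ φ (∗ , i) z (product G zs) [] ⟩
      to (productAlong φ (∗ , i) z) (to (productAlong φ ((∗ , i) Oriented.▷ z) (product G zs)) [])
        ≡⟨ cong (λ q → to (productAlong φ (∗ , i) z) (to (productAlong φ q (product G zs)) []))
             (×-≡,≡→≡ (trans (oriented-▷ ∗ i z) (∈H⇒▷ (prime∈H p)) , refl)) ⟩
      to (productAlong φ (∗ , i) z) (to (productAlong φ (∗ , proj₂ ((∗ , i) Oriented.▷ z)) (product G zs)) [])
        ≡⟨ cong (to (productAlong φ (∗ , i) z)) (evaluate _ zs ps ls (Linked.tail ns)) ⟩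
      to (productAlong φ (∗ , i) z) zs
        ≡⟨ φ-value i p l (Linked.tail ns) ⟩
      push z zs
        ≡⟨ pushed ns ⟩
      z ∷ zs ∎
      where
      open ≡-Reasoning
      pushed : ∀ {zs} → NoInverses (z ∷ zs) → push z zs ≡ z ∷ zs
      pushed [-]      = refl
      pushed (ne ∷ _) = push-≢ _ ne

-- Auxiliary facts: finite search, generated subgroups, coding of functions.

anyWord? : ∀ {n} m {P : Pred (Word n) p} → (∀ w → Dec (P w)) → Dec (∃ λ w → length w ≡ m × P w)
anyWord? zero    P? = map′ (λ p → [] , refl , p) (λ { ([] , _ , p) → p }) (P? [])
anyWord? (suc m) P? = map′ (λ (a , w , e , p) → a ∷ w , cong suc e , p) (λ { (a ∷ w , e , p) → a , w , ℕ.suc-injective e , p })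
  (Fin.any? λ a → anyWord? m (λ w → P? (a ∷ w)))

splitWord : ∀ {n} m (w : Word n) → m ≤ length w → ∃₂ λ u v → w ≡ u ++ v × length u ≡ m
splitWord zero    w       _       = [] , w , refl , refl
splitWord (suc m) (a ∷ w) (s≤s l) with splitWord m w l
... | u , v , refl , refl = a ∷ u , v , refl , refl

module _ (G : Group c ℓ) {X : Pred (Group.Carrier G) p}
         (X-inverse : ∀ {g} → g ∈ X → Group._⁻¹ G g ∈ X) where
  open Group G renaming (sym to ≈sym; trans to ≈trans; refl to ≈refl)
  open import Algebra.Properties.Group G

  private
    K : Pred Carrier _
    K = GeneratedMonoid G X

    product-++ : ∀ xs ys → product G (xs ++ ys) ≈ product G xs ∙ product G ys
    product-++ []       ys = ≈sym (identityˡ _)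
    product-++ (x ∷ xs) ys = ≈trans (∙-congˡ (product-++ xs ys)) (≈sym (assoc _ _ _))

    K-resp : ∀ {g k} → g ≈ k → g ∈ K → k ∈ K
    K-resp e (xs , p , f) = xs , p , ≈trans (≈sym e) f

    K-∙ : ∀ {g k} → g ∈ K → k ∈ K → (g ∙ k) ∈ K
    K-∙ (xs , p , e) (ys , q , f) = xs ++ ys , All.++⁺ p q , ≈trans (∙-cong e f) (≈sym (product-++ xs ys))

    product⁻¹ : ∀ {xs} → All X xs → (product G xs ⁻¹) ∈ K
    product⁻¹ [] = [] , [] , ε⁻¹≈ε
    product⁻¹ {x ∷ xs} (p ∷ ps) = K-resp (≈sym (⁻¹-anti-homo-∙ x (product G xs)))
      (K-∙ (product⁻¹ ps) ([ x ⁻¹ ] , X-inverse p ∷ [] , ≈sym (identityʳ _)))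

  generatedMonoid-subgroup : IsSubgroup G (GeneratedMonoid G X)
  generatedMonoid-subgroup = record
    { resp      = K-resp
    ; ε-closed  = [] , [] , ≈refl
    ; ∙-closed  = K-∙
    ; ⁻¹-closed = λ (xs , ps , e) → K-resp (⁻¹-cong (≈sym e)) (product⁻¹ ps)
    }

indicator : ∀ {A : Set a} → DecidableEquality A → (xs : List A) → (Fin (length xs) → Bool) → A → Bool
indicator _≟_ []       g x = false
indicator _≟_ (y ∷ ys) g x with x ≟ y
... | yes _ = g zero
... | no  _ = indicator _≟_ ys (g ∘ suc) x

indicator-lookup : ∀ {A : Set a} (_≟_ : DecidableEquality A) {xs} → Unique xs → ∀ g i → indicator _≟_ xs g (lookup xs i) ≡ g i
indicator-lookup _≟_ {y ∷ ys} (y∉ ∷ u) g zero with y ≟ y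
... | yes _ = refl
... | no ¬p = ⊥-elim (¬p refl)
indicator-lookup _≟_ {y ∷ ys} (y∉ ∷ u) g (suc i) with lookup ys i ≟ y
... | yes e = ⊥-elim (All.lookup y∉ (∈-lookup i) (sym e))
... | no _  = indicator-lookup _≟_ u (g ∘ suc) i

funToFin-cong : ∀ {m n} {f g : Fin m → Fin n} → f ≗ g → funToFin f ≡ funToFin g
funToFin-cong {zero}  e = refl
funToFin-cong {suc m} e = cong₂ combine (e zero) (funToFin-cong (e ∘ suc))

finToFun-injective : ∀ {m n} {i j : Fin (n ^ m)} → finToFun {n} {m} i ≗ finToFun j → i ≡ j
finToFun-injective {m} {n} {i} {j} e =
  trans (sym (Fin.funToFin-finToFin {m} {n} i)) (trans (funToFin-cong e) (Fin.funToFin-finToFin {m} {n} j))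

fromBool : Bool → Fin 2
fromBool false = zero
fromBool true  = suc zero

toBool : Fin 2 → Bool
toBool zero    = false
toBool (suc _) = true

fromBool-injective : ∀ {x y} → fromBool x ≡ fromBool y → x ≡ y
fromBool-injective {false} {false} _ = refl
fromBool-injective {true}  {true}  _ = refl

toBool-injective : ∀ {x y} → toBool x ≡ toBool y → x ≡ y
toBool-injective {zero}     {zero}     _ = refl
toBool-injective {suc zero} {suc zero} _ = refl

-- Finiteness of the prime words, and generation of the subgroup by them.

module Generation {n} (θ : Fin n → Fin n) (θ-inv : Involutive _≡_ θ)
  (S : Pred (Word n) s) (specular : IsSpecular θ S) (isRecurrent : IsRecurrent S)
  (H : Pred (Word n) h) (subgroup : IsSubgroup (groupOf θ θ-inv) H) {d} (index : HasIndex (groupOf θ θ-inv) H d) where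

  open FiniteIndex θ θ-inv S specular H subgroup index public
  open IsRecurrent isRecurrent using (recurrent)
  open IsSubgroup subgroup

  -- Every ℤ₂-valued function on a set of k prime words comes from one of the
  -- 2 ^ (d * n) functions on Fin d × Fin n.
  primes-finite : ∀ {xs} → Unique xs → All Prime xs → length xs ≤ d ℕ.* n
  primes-finite {xs} unique primes = ℕ.≮⇒≥ λ lt → absurd (Fin.pigeonhole (ℕ.^-monoʳ-< 2 (s≤s (s≤s z≤n)) lt) code)
    where
    k = length xs
    N = length (product G xs)

    values : Fin (2 ^ k) → Word n → Bool
    values i = indicator _≟ʷ_ xs (toBool ∘ finToFun {2} {k} i)

    ν : Fin (2 ^ k) → Fin d → Fin n → Bool
    ν i = proj₁ (Cocycles.primeExtension ℤ₂ N (values i))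

    table : Fin (2 ^ k) → Fin (d ℕ.* n) → Fin 2
    table i r = fromBool (ν i (proj₁ (remQuot n r)) (proj₂ (remQuot {d} n r)))

    code : Fin (2 ^ k) → Fin (2 ^ (d ℕ.* n))
    code i = funToFin (table i)

    open Values ℤ₂

    productAlong-cong : ∀ {ν ν′ : Fin d → Fin n → Bool} → (∀ q b → ν q b ≡ ν′ q b) → ∀ q w → productAlong ν q w ≡ productAlong ν′ q w
    productAlong-cong e q []      = refl
    productAlong-cong e q (b ∷ w) = cong₂ (Group._∙_ ℤ₂) (e q b) (productAlong-cong e (q · b) w)

    code-injective : ∀ {i j} → code i ≡ code j → i ≡ j
    code-injective {i} {j} e = finToFun-injective {k} {2} λ r → toBool-injective (begin
      toBool (finToFun i r)                ≡⟨ indicator-lookup _≟ʷ_ unique (toBool ∘ finToFun {2} {k} i) r ⟨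
      values i (lookup xs r)               ≡⟨ correct i r ⟨
      productAlong (ν i) ∗ (lookup xs r)   ≡⟨ productAlong-cong same ∗ (lookup xs r) ⟩
      productAlong (ν j) ∗ (lookup xs r)   ≡⟨ correct j r ⟩
      values j (lookup xs r)               ≡⟨ indicator-lookup _≟ʷ_ unique (toBool ∘ finToFun {2} {k} j) r ⟩
      toBool (finToFun j r)                ∎)
      where
      open ≡-Reasoning
      correct : ∀ i r → productAlong (ν i) ∗ (lookup xs r) ≡ values i (lookup xs r)
      correct i r = proj₂ (Cocycles.primeExtension ℤ₂ N (values i))
        (All.lookup primes (∈-lookup r)) (All.lookup (length-factors xs) (∈-lookup r))
      same-table : ∀ r → table i r ≡ table j r
      same-table r = trans (sym (Fin.finToFun-funToFin (table i) r)) (trans (cong (λ z → finToFun z r) e) (Fin.finToFun-funToFin (table j) r))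
      same : ∀ q b → ν i q b ≡ ν j q b
      same q b = fromBool-injective (subst (λ qb → fromBool (ν i (proj₁ qb) (proj₂ qb)) ≡ fromBool (ν j (proj₁ qb) (proj₂ qb)))
        (Fin.remQuot-combine q b) (same-table (combine q b)))

    absurd : (∃₂ λ i j → toℕ i < toℕ j × code i ≡ code j) → ⊥
    absurd (i , j , i<j , e) = ℕ.<-irrefl (cong toℕ (code-injective e)) i<j

  module _ {w : Word n} (w∈ : w ∈ S) where

    -- Recurrence puts one more `w` behind the word found so far, so every position contains all
    -- earlier occurrences.
    occurrence : ℕ → ∃ λ g → g ++ w ∈ S
    occurrence zero    = [] , w∈
    occurrence (suc m) = let g , p = occurrence m ; v , _ , q = recurrent p w∈ in
      (g ++ w) ++ v , subst (_∈ S) (sym (++-assoc (g ++ w) v w)) q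

    position : ℕ → Word n
    position m = proj₁ (occurrence m)

    position-< : ∀ {i j} → i < j → ∃ λ r → position j ≡ position i ++ w ++ r
    position-< {i} {suc j} (s≤s i≤j) with ℕ.m≤n⇒m<n∨m≡n i≤j
    ... | inj₂ refl = _ , ++-assoc (position j) w _
    ... | inj₁ i<j  = let r , e = position-< i<j in (r ++ w) ++ v , (begin
        (position j ++ w) ++ v                       ≡⟨ cong (λ z → (z ++ w) ++ v) e ⟩
        ((position i ++ w ++ r) ++ w) ++ v           ≡⟨ cong (_++ v) (++-assoc (position i) (w ++ r) w) ⟩
        (position i ++ (w ++ r) ++ w) ++ v           ≡⟨ ++-assoc (position i) _ v ⟩
        position i ++ ((w ++ r) ++ w) ++ v           ≡⟨ cong (λ z → position i ++ z ++ v) (++-assoc w r w) ⟩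
        position i ++ (w ++ r ++ w) ++ v             ≡⟨ cong (position i ++_) (++-assoc w (r ++ w) v) ⟩
        position i ++ w ++ (r ++ w) ++ v             ∎)
      where
      open ≡-Reasoning
      v = proj₁ (recurrent (proj₂ (occurrence j)) w∈)

    -- Two of d + 1 successive occurrences of w start in the same left coset.
    extends-to-H : ∃ λ r → w ++ r ∈ S × w ++ r ∈ H
    extends-to-H with Fin.pigeonhole (ℕ.n<1+n d) (λ i → coset (inverse θ (position (toℕ i))))
    ... | i , j , i<j , e = r , factors g (w ++ r) w (subst (_∈ S) (trans (cong (_++ w) g′≡) (++-assoc g (w ++ r) w)) (proj₂ (occurrence (toℕ j))))
                          , resp cancel (coset⇒~ {inverse θ g} {inverse θ g′} e)
      where
      g  = position (toℕ i)
      g′ = position (toℕ j)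
      r  = proj₁ (position-< i<j)
      g′≡ : g′ ≡ g ++ w ++ r
      g′≡ = proj₂ (position-< i<j)
      cancel : inverse θ g ++ inverse θ (inverse θ g′) G.≈ w ++ r
      cancel = G.trans (G.reflexive (cong (inverse θ g ++_) (trans (inverse-involutive θ θ-inv g′) g′≡)))
        (G.trans (G.sym (G.assoc (inverse θ g) g (w ++ r))) (G.∙-congʳ {w ++ r} (G.inverseˡ g)))

    -- Continued to an element of `H`, the word comes back to `∗`; cutting at the first return after
    -- `w` gives a prime word, because `w` itself does not return.
    extends-to-prime : w ≢ [] → Avoids⁺ ∗ w → ∃ λ u → w ++ u ∈ Prime
    extends-to-prime w≢ av =
      let r , wr∈S , wr∈H = extends-to-H
          returns = trans (sym (▷-++ ∗ w r)) (∈H⇒▷ wr∈H)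
          u , v , r≡ , fr = firstReturn Fin._≟_ (∗ ▷ w) r
            (λ r≡ → avoids⁺-last w w≢ av (subst (λ z → ∗ ▷ w ▷ z ≡ ∗) r≡ returns)) returns
      in u , firstReturn⇒prime (prefix∈ (w ++ u) v (subst (_∈ S) (trans (cong (w ++_) r≡) (sym (++-assoc w u v))) wr∈S))
               (prepend-avoiding⁺ w av fr)

  HasPrimePrefix : Pred (Word n) (s ⊔ h)
  HasPrimePrefix w = ∃₂ λ u v → w ≡ u ++ v × u ∈ Prime

  -- If some word longer than all primes collected has no prime prefix, it extends to a new prime.
  -- This can happen at most `d * n` times, by `primes-finite`.
  longWords : ∃ λ m → ∀ {w} → w ∈ S → m ≤ length w → HasPrimePrefix w
  longWords = search (suc (d ℕ.* n)) [] [] [] (ℕ.≤-reflexive (sym (ℕ.+-identityʳ _)))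
    where
    search : ∀ fuel xs → Unique xs → All Prime xs → suc (d ℕ.* n) ≤ fuel ℕ.+ length xs →
             ∃ λ m → ∀ {w} → w ∈ S → m ≤ length w → HasPrimePrefix w
    search zero       xs unique primes l = ⊥-elim (ℕ.<-irrefl refl (ℕ.≤-trans l (primes-finite unique primes)))
    search (suc fuel) xs unique primes l with anyWord? m (λ w → w ∈S? ×-dec avoids⁺? Fin._≟_ ∗ w)
      -- Any prime with a prefix of this length is longer than all those in `xs`, hence new.
      where m = suc (length (product G xs))
    ... | yes (w , |w| , w∈ , av) =
      let u , prime = extends-to-prime w∈ (λ w≡ → case trans (sym |w|) (cong length w≡) of λ ()) av
          longer : length (product G xs) < length (w ++ u)
          longer = subst₂ _≤_ |w| (sym (length-++ w)) (ℕ.m≤m+n _ _)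
      in search fuel ((w ++ u) ∷ xs)
           (All.map (λ le eq → ℕ.<-irrefl (cong length (sym eq)) (ℕ.<-≤-trans (s≤s le) longer)) (length-factors xs) ∷ unique)
           (prime ∷ primes) (subst (suc (d ℕ.* n) ≤_) (sym (ℕ.+-suc fuel (length xs))) l)
    ... | no ¬long = suc (length (product G xs)) , λ {w} w∈ le →
      let w₁ , w₂ , w≡ , |w₁| = splitWord _ w le
          w₁∈ = prefix∈ w₁ w₂ (subst (_∈ S) w≡ w∈)
          u , v , w₁≡ , fr = ¬avoids⇒firstReturn Fin._≟_ ∗ w₁ (λ av → ¬long (w₁ , |w₁| , w₁∈ , av))
      in u , v ++ w₂ , trans w≡ (trans (cong (_++ w₂) w₁≡) (++-assoc u v w₂))
           , firstReturn⇒prime (prefix∈ u v (subst (_∈ S) w₁≡ w₁∈)) fr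

  X : Pred (Word n) (s ⊔ h)
  X = Saturation G Prime

  K : Pred (Word n) (s ⊔ h)
  K = GeneratedMonoid G X

  X-inverse : ∀ {g} → g ∈ X → inverse θ g ∈ X
  X-inverse (y , p , e) = inverse θ y , prime-inverse p , G.⁻¹-cong e

  K-subgroup : IsSubgroup G K
  K-subgroup = generatedMonoid-subgroup G X-inverse

  module Kᶜ = RightCosets G K-subgroup
  open Kᶜ using () renaming (_~_ to _~ᴷ_)

  prime∈K : ∀ {y} → y ∈ Prime → y ∈ K
  prime∈K {y} p = [ y ] , (y , p , G.refl) ∷ [] , G.sym (G.identityʳ y)

  K⊆H : K ⊆ H
  K⊆H (xs , ps , e) = resp (G.sym e) (products ps)
    where
    products : ∀ {xs} → All X xs → product G xs ∈ H
    products []                     = ε-closed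
    products {x ∷ xs} ((y , p , e) ∷ ps) = ∙-closed {x} {product G xs} (resp e (prime∈H p)) (products ps)

  -- Cutting the word at its successive returns to `∗` factors it into prime words.
  H∩S⊆K : ∀ {w} → w ∈ S → w ∈ H → w ∈ K
  H∩S⊆K {w} = go (length w) w ℕ.≤-refl
    where
    go : ∀ m w → length w ≤ m → w ∈ S → w ∈ H → w ∈ K
    go m       []        _       _  _  = IsSubgroup.ε-closed K-subgroup
    go (suc m) w@(_ ∷ _) (s≤s l) w∈ w∈H with firstReturn Fin._≟_ ∗ w (λ ()) (∈H⇒▷ w∈H)
    ... | []    , v , refl , ()
    ... | u@(_ ∷ u′) , v , refl , fr = IsSubgroup.∙-closed K-subgroup {u} {v}
      (prime∈K (firstReturn⇒prime (prefix∈ u v w∈) fr))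
      (go m v (ℕ.≤-trans (subst (length v ≤_) (sym (length-++ u′)) (ℕ.m≤n+m _ _)) l) (suffix∈ u v w∈)
        (▷⇒∈H (trans (cong (_▷ v) (sym (firstReturn-returns fr))) (trans (sym (▷-++ ∗ u v)) (∈H⇒▷ w∈H)))))

  -- T assigns to each word of length m of S a set of right cosets of K; the
  -- axioms say that it is transported by the letters along S and that each of
  -- its sets contains K and is mapped injectively to the right cosets of H.
  record Family (m : ℕ) : Set (Level.suc (s ⊔ h)) where
    field
      T         : Word n → Pred (Word n) (s ⊔ h)
      resp-≈    : ∀ {w t t′} → t G.≈ t′ → T w t → T w t′
      base      : ∀ {w} → w ∈ S → length w ≡ m → T w []
      injective : ∀ {w t t′} → w ∈ S → length w ≡ m → T w t → T w t′ → Hᶜ._~_ t t′ → t ~ᴷ t′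
      shift     : ∀ {a w w′ b t} → a ∷ w′ ∈ S → a ∷ w′ ≡ w ∷ʳ b → length w ≡ m → T w t → T w′ (t ∷ʳ b)
      unshift   : ∀ {a w w′ b t} → a ∷ w′ ∈ S → a ∷ w′ ≡ w ∷ʳ b → length w ≡ m → T w′ (t ∷ʳ b) → T w t

  module AlongWalks {m} (F : Family (suc m)) {w : Word n} (|w| : length w ≡ m) where
    open Family F

    -- At a right vertex the set is pulled back along `b`, so that `shift` and `unshift` identify
    -- the sets at the two ends of an edge.
    Tᵛ : V → Pred (Word n) (s ⊔ h)
    Tᵛ (inj₁ a) t = T (a ∷ w) t
    Tᵛ (inj₂ b) t = T (w ∷ʳ b) (t ∷ʳ b)

    along : ∀ {u v xs} → Walks.Walk (ℰ w) u xs v → ∀ {t} → Tᵛ u t → Tᵛ v t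
    along Walks.[] y = y
    along ((_ , _ , edge p) Walks.∷ ws)  y = along ws (shift p refl (cong suc |w|) y)
    along ((_ , _ , edge⁻ p) Walks.∷ ws) y = along ws (unshift p refl (cong suc |w|) y)

  -- The extension graph of a nonempty `w` is connected, so the set at `a ∷ w` is the same for all
  -- possible `a`. For the empty word this fails, which is why the lowering ends at length 1.
  lowerFamily : ∀ {m} → Family (suc (suc m)) → Family (suc m)
  lowerFamily {m} F = record
    { T = T′
    ; resp-≈ = λ e (a , p , y) → a , p , resp-≈ e y
    ; base = λ w∈ |w| → let a , b , p = extendable w∈ ; p′ = prefix∈ (a ∷ _) [ b ] p in
        a , p′ , base p′ (cong suc |w|)
    ; injective = λ w∈ |w| (a , p , y) (a′ , p′ , y′) e →
        injective p (cong suc |w|) y (switch |w| p′ p y′) e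
    -- The given letter `c` need not precede `w ∷ʳ b`, so it is first switched to some `c′` that
    -- does.
    ; shift = λ {a} {w} {w′} {b} p eq |w| (c , q , y) →
        let c′ , p′ = extendˡ (subst (_∈ S) eq p) ; q′ = prefix∈ (c′ ∷ w) [ b ] p′ in
        a , p , subst (λ z → T z _) (sym eq) (shift p′ refl (cong suc |w|) (switch |w| q q′ y))
    ; unshift = λ {a} {w} {w′} {b} p eq |w| (c , q , y) →
        let c′ , p′ = extendˡ (subst (_∈ S) eq p) ; q′ = prefix∈ (c′ ∷ w) [ b ] p′ in
        c′ , q′ , unshift p′ refl (cong suc |w|) (subst (λ z → T z _) eq (switch (|w′| eq |w|) q p y))
    }
    where
    open Family F
    T′ : Word n → Pred (Word n) (s ⊔ h)
    T′ w t = ∃ λ a → a ∷ w ∈ S × T (a ∷ w) t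

    switch : ∀ {w a a′ t} → length w ≡ suc m → a ∷ w ∈ S → a′ ∷ w ∈ S → T (a ∷ w) t → T (a′ ∷ w) t
    switch {w} {a} |w| p p′ = AlongWalks.along F |w|
      (proj₂ (nonempty-walk (suffix∈ [ a ] w p) (λ w≡ → case trans (sym |w|) (cong length w≡) of λ ()) (left p) (left p′)))

    extendˡ : ∀ {w} → w ∈ S → ∃ λ c → c ∷ w ∈ S
    extendˡ w∈ = let c , b , p = extendable w∈ in c , prefix∈ (c ∷ _) [ b ] p

    |w′| : ∀ {a b} {w w′ : Word n} → a ∷ w′ ≡ w ∷ʳ b → length w ≡ suc m → length w′ ≡ suc m
    |w′| {b = b} {w} eq |w| = ℕ.suc-injective (trans (cong length eq) (trans (length-∷ʳ w b) (cong suc |w|)))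

  Suffixes : Word n → Pred (Word n) (s ⊔ h)
  Suffixes w t = ∃₂ λ r s → w ≡ r ++ s × t ~ᴷ s

  module _ {m : ℕ} (long : ∀ {w} → w ∈ S → m ≤ length w → HasPrimePrefix w) where

    -- Only the suffix `a ∷ w` itself gets lost. Removing a prime prefix from it does not change its
    -- coset of `K` and leaves a suffix of `w`.
    suffixes-∷ : ∀ {a w t} → a ∷ w ∈ S → m ≤ length (a ∷ w) → Suffixes (a ∷ w) t → Suffixes w t
    suffixes-∷ aw∈ l (_ ∷ r , s , eq , e) = r , s , ∷-injectiveʳ eq , e
    suffixes-∷ {a} {w} {t} aw∈ l ([] , s , refl , e) with long aw∈ l
    ... | []    , v , eq , p = ⊥-elim (IsPrimeWord.nonempty p refl)
    ... | c ∷ u , v , eq , p = u , v , ∷-injectiveʳ eq ,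
      Kᶜ.~-trans {t} {c ∷ u ++ v} {v} (subst (t ~ᴷ_) eq e) (Kᶜ.∙~ {c ∷ u} v (prime∈K p))

    -- A nonempty suffix ends in `b`, which cancels. The empty suffix stands for the coset `K` and
    -- is replaced by a prime suffix, the inverse of a prime prefix of the inverse word.
    suffixes-∷ʳ : ∀ {w b t} → w ∷ʳ b ∈ S → m ≤ length (w ∷ʳ b) → Suffixes (w ∷ʳ b) (t ∷ʳ b) → Suffixes w t
    suffixes-∷ʳ {w} {b} {t} wb∈ l (r , s , eq , e) = go r (initLast s) eq e
      where
      nonempty : ∀ r s {c} → w ∷ʳ b ≡ r ++ s ∷ʳ c → (t ∷ʳ b) ~ᴷ (s ∷ʳ c) → Suffixes w t
      nonempty r s eq e with ∷ʳ-injective w (r ++ s) (trans eq (sym (++-assoc r s _)))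
      ... | w≡ , refl = r , s , w≡ , Kᶜ.~-cancel {t} {s} [ b ] e
      go : ∀ r {s} → InitLast s → w ∷ʳ b ≡ r ++ s → (t ∷ʳ b) ~ᴷ s → Suffixes w t
      go r (s ∷ʳ′ c) eq e = nonempty r s eq e
      go r []        eq e with long (inverseClosed wb∈) (subst (m ≤_) (sym (length-inverse θ (w ∷ʳ b))) l)
      ... | u , v , eq′ , p with initLast (inverse θ u) | prime-inverse p | wb≡
        where
        wb≡ : w ∷ʳ b ≡ inverse θ v ++ inverse θ u
        wb≡ = trans (sym (inverse-involutive θ θ-inv (w ∷ʳ b))) (trans (cong (inverse θ) eq′) (inverse-++ θ u v))
      ...   | ū | p̄ | wb≡ = last ū p̄ wb≡
        where
        last : ∀ {s} → InitLast s → s ∈ Prime → w ∷ʳ b ≡ inverse θ v ++ s → Suffixes w t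
        last []        p̄ _   = ⊥-elim (IsPrimeWord.nonempty p̄ refl)
        last (s ∷ʳ′ c) p̄ eq″ = nonempty (inverse θ v) s eq″
          (Kᶜ.~-trans {t ∷ʳ b} {[]} {s ∷ʳ c} e (Kᶜ.~-sym {s ∷ʳ c} {[]} (Kᶜ.∈⇒~ε (prime∈K p̄))))

    suffixFamily : Family m
    suffixFamily = record
      { T = Suffixes
      ; resp-≈ = λ {_} {t} {t′} e (r , s , eq , f) → r , s , eq , Kᶜ.~-trans {t′} {t} {s} (Kᶜ.~-reflexive (G.sym e)) f
      ; base = λ {w} _ _ → w , [] , sym (++-identityʳ w) , Kᶜ.~-reflexive {[]} {[]} G.refl
      ; injective = λ { {t = t} {t′} w∈ _ (r , s , refl , e) (r′ , s′ , eq′ , e′) f →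
          Kᶜ.~-trans {t} {s} {t′} e (Kᶜ.~-trans {s} {s′} {t′} (compare r r′ w∈ eq′
            (Hᶜ.~-trans {s} {t} {s′} (Hᶜ.~-sym {t} {s} (K⇒H {t} {s} e)) (Hᶜ.~-trans {t} {t′} {s′} f (K⇒H {t′} {s′} e′))))
            (Kᶜ.~-sym {t′} {s′} e′)) }
      ; shift = λ { {a} {w} {w′} {b} {t} p eq |w| (r , s , refl , e) →
          suffixes-∷ p (long-enough eq |w|) (r , s ∷ʳ b , trans eq (++-assoc r s [ b ]) , Kᶜ.~-∙ {t} {s} [ b ] e) }
      ; unshift = λ { {a} {w} {w′} {b} {t} p eq |w| (r , s , w′≡ , e) →
          suffixes-∷ʳ {w} {b} {t} (subst (_∈ S) eq p) (subst (λ z → m ≤ length z) eq (long-enough eq |w|))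
            (a ∷ r , s , trans (sym eq) (cong (a ∷_) w′≡) , e) }
      }
      where
      long-enough : ∀ {a b} {w w′ : Word n} → a ∷ w′ ≡ w ∷ʳ b → length w ≡ m → m ≤ length (a ∷ w′)
      long-enough {b = b} {w} eq |w| = subst (m ≤_) (sym (trans (cong length eq) (length-∷ʳ w b))) (subst (λ k → m ≤ suc k) (sym |w|) (ℕ.n≤1+n m))
      K⇒H : ∀ {g k} → g ~ᴷ k → Hᶜ._~_ g k
      K⇒H = K⊆H
      -- The longer of the two suffixes is the other one preceded by a word of `S`. Equality of
      -- their cosets of `H` puts this word into `H`, hence into `K` by `H∩S⊆K`.
      compare : ∀ {s s′} r r′ → r ++ s ∈ S → r ++ s ≡ r′ ++ s′ → Hᶜ._~_ s s′ → s ~ᴷ s′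
      compare {s} {s′} [] r′ s∈ refl e = Kᶜ.∙~ {r′} s′ (H∩S⊆K (prefix∈ r′ s′ s∈) (cancelH {r′} {s′} e))
        where
        cancelH : ∀ {g k} → Hᶜ._~_ (g ++ k) k → g ∈ H
        cancelH {g} {k} f = Hᶜ.~ε⇒∈ (Hᶜ.~-cancel {g} {[]} k f)
      compare {s} {s′} (a ∷ r) [] s∈ refl e = Kᶜ.~-sym {s′} {s} (compare [] (a ∷ r) s∈ refl (Hᶜ.~-sym {s} {s′} e))
      compare {s} {s′} (a ∷ r) (a′ ∷ r′) s∈ eq e = compare r r′ (suffix∈ [ a ] (r ++ s) s∈) (∷-injectiveʳ eq) e

  letterFamily : Family 1
  -- The length from `longWords` is increased by one to be positive, as lowering needs.
  letterFamily = lower (proj₁ longWords) (suffixFamily λ w∈ l → proj₂ longWords w∈ (ℕ.≤-trans (ℕ.n≤1+n _) l))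
    where
    lower : ∀ m → Family (suc m) → Family 1
    lower zero    F = F
    lower (suc m) F = lower m (lowerFamily F)

  -- Reading `g` from the empty word keeps the coset of what has been read in the set of the current
  -- tree. At the end both `g` and the empty word lie in one set; they agree modulo `H`, hence
  -- modulo `K`.
  H⊆K : H ⊆ K
  H⊆K {g} g∈ with read g [] (compL someLetter) (someLetter , refl , base (letters someLetter) refl)
    where
    open Family letterFamily
    open AlongWalks letterFamily {[]} refl
    Tᶜ : Fin 2 → Pred (Word n) (s ⊔ h)
    Tᶜ i t = ∃ λ a → compL a ≡ i × T [ a ] t

    -- Forwards, a walk in the tree leads to the right vertex `b`. Backwards, it leads to the left
    -- vertex `θ b`; with `t` rewritten as `t b θ(b)`, unshifting along an edge `c θ(b)` places
    -- `t b` in the set of `c`.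
    move : ∀ {i b t} → Dec (compR b ≡ i) → Tᶜ i t → Tᶜ (next i b) (t ∷ʳ b)
    move {i} {b} (yes e) (a , a≡ , y) = b , sym (next-compR e) , along (proj₂ (component-walk (trans a≡ (sym e)))) y
    move {i} {b} {t} (no ¬e) (a , a≡ , y) =
      let c , _ , p = extendable (letters (θ b)) ; p′ = prefix∈ (c ∷ θ b ∷ []) _ p in
      c , trans (component-edge p′) (sym (next-≢compR ¬e)) ,
      unshift p′ refl refl (resp-≈ (cancel b t) (along {inj₁ a} {inj₁ (θ b)} (proj₂ (component-walk (trans a≡ (sym (compL-θ ¬e))))) y))
      where
      cancel : ∀ b t → t G.≈ (t ∷ʳ b) ∷ʳ θ b
      cancel b t = G.sym (G.trans (G.assoc t [ b ] [ θ b ]) (G.trans (G.∙-congˡ {t} (relator b)) (G.identityʳ t)))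

    read : ∀ w t i → Tᶜ i t → ∃ λ j → Tᶜ j (t ++ w)
    read []      t i y = i , subst (Tᶜ i) (sym (++-identityʳ t)) y
    read (b ∷ w) t i y =
      let j , z = read w (t ∷ʳ b) (next i b) (move (compR b Fin.≟ i) y) in j , subst (Tᶜ j) (++-assoc t [ b ] w) z
  ... | j , a , _ , y = Kᶜ.~ε⇒∈ (Family.injective letterFamily {t = g} {[]} (letters a) refl y
          (Family.base letterFamily (letters a) refl) (Hᶜ.∈⇒~ε g∈))

  module _ where
    private variable
      xs : List (Word n)

    primeFactors : All X xs → List (Word n)
    primeFactors []             = []
    primeFactors ((y , _) ∷ ps) = y ∷ primeFactors ps

    primeFactors-prime : (ps : All X xs) → All Prime (primeFactors ps)
    primeFactors-prime []                 = []
    primeFactors-prime ((_ , p , _) ∷ ps) = p ∷ primeFactors-prime ps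

    primeFactors-product : (ps : All X xs) → product G xs G.≈ product G (primeFactors ps)
    primeFactors-product []                 = G.refl
    primeFactors-product ((_ , _ , e) ∷ ps) = G.∙-cong (G.sym e) (primeFactors-product ps)

    primeFactors-noInverses : (ps : All X xs) → Linked (λ y z → ¬ (y ++ z G.≈ [])) xs → NoInverses (primeFactors ps)
    primeFactors-noInverses []       []  = []
    primeFactors-noInverses (_ ∷ []) [-] = [-]
    primeFactors-noInverses ((y , _ , e) ∷ ps@((z , _ , f) ∷ _)) (ne ∷ ls) =
      (λ z≡ → ne (G.trans (G.∙-cong (G.sym e) (G.sym f)) (subst (λ z → y ++ z G.≈ []) (sym z≡) (G.inverseʳ y))))
      ∷ primeFactors-noInverses ps ls

    X-free : xs ≢ [] → All X xs → Linked (λ y z → ¬ (y ++ z G.≈ [])) xs → ¬ (product G xs G.≈ [])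
    X-free xs≢ []          _  _ = xs≢ refl
    X-free _   ps@(_ ∷ _) ls e =
      case primes-free (primeFactors-prime ps) (primeFactors-noInverses ps ls) (G.trans (G.sym (primeFactors-product ps)) e) of λ ()

theorem8p4 : ∀ {s h : Level} {n : ℕ} (θ : Fin n → Fin n) (θ-inv : Involutive _≡_ θ)
    (S : Pred (Word n) s) → IsSpecular θ S → IsRecurrent S →
    (H : Pred (Word n) h) → IsSubgroup (groupOf θ θ-inv) H → HasFiniteIndex (groupOf θ θ-inv) H →
    IsMonoidalBasis (groupOf θ θ-inv) H (Saturation (groupOf θ θ-inv) (IsPrimeWord S H))
theorem8p4 θ θ-inv S specular isRecurrent H subgroup (_ , index) = record
  { subset        = λ (_ , p , e) → IsSubgroup.resp subgroup e (prime∈H p)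
  ; inverseClosed = X-inverse
  ; generates     = K⊆H , H⊆K
  ; nontrivial    = X-free
  }
  where open Generation θ θ-inv S specular isRecurrent H subgroup index
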